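{- Let $d\ge 14$ and $k\in\mathbb{N}$. In the ordered chain game on the $d$-dimensional $k$-wedge $W^d_k$, Walker has a strategy to build a chain of size $k$ (i.e., a chain containing an element of every level $0,1,\dots,k-1$).
   Context: The $d$-dimensional $k$-wedge $W^d_k$ is the poset of nonnegative integer $d$-tuples with coordinate sum less than $k$, ordered coordinatewise ($x\preceq y$ iff $x_i\le y_i$ for all $i$); level $\ell$ is the set of tuples with coordinate sum $\ell$. In the ordered chain game (Walker-Blocker game) on a finite poset, Walker and Blocker alternately (Walker first) choose previously unchosen elements until all are chosen. Walker builds a chain of size $m$ if there are elements $x_1\prec x_2\prec\cdots\prec x_m$ all chosen by Walker, chosen in this order in time (the chain is built from bottom to top). -}

module Defs where

open import Data.Nat using (ℕ; _≤_; _<_)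
open import Data.Vec using (Vec; sum)
open import Data.Vec.Relation.Binary.Pointwise.Inductive using (Pointwise)
open import Data.List using (List; []; _∷_; _∷ʳ_; length)
open import Data.List.Membership.Propositional using (_∈_; _∉_)
open import Data.List.Relation.Binary.Sublist.Propositional using (_⊆_)
open import Data.List.Relation.Unary.Linked using (Linked)
open import Data.Product using (Σ; _×_)
open import Relation.Binary.PropositionalEquality using (_≡_; _≢_)
open import Relation.Nullary using (¬_)

Pt : ℕ → Set
Pt d = Vec ℕ d

InWedge : {d : ℕ} → ℕ → Pt d → Set
InWedge k x = sum x < k

_⪯_ : {d : ℕ} → Pt d → Pt d → Set
x ⪯ y = Pointwise _≤_ x y

_≺_ : {d : ℕ} → Pt d → Pt d → Set
x ≺ y = (x ⪯ y) × (x ≢ y)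

-- A history is the list of chosen elements in chronological order.
-- Walker chooses the elements at even (0-based) positions, Blocker the odd ones.
mutual
  walkerPart : {A : Set} → List A → List A
  walkerPart [] = []
  walkerPart (x ∷ xs) = x ∷ blockerPart xs

  blockerPart : {A : Set} → List A → List A
  blockerPart [] = []
  blockerPart (x ∷ xs) = walkerPart xs

Complete : (d k : ℕ) → List (Pt d) → Set
Complete d k h = (x : Pt d) → InWedge k x → x ∈ h

BuildsChain : {d : ℕ} → ℕ → List (Pt d) → Set
BuildsChain {d} m h =
  Σ (List (Pt d)) λ c → (c ⊆ walkerPart h) × (length c ≡ m) × Linked _≺_ c

-- Walker-Blocker (ordered chain) game on W^d_k with target chain size m.
-- WalkerWinsW h : it is Walker's turn at history h and Walker has a
-- strategy guaranteeing that at the end of the game (all elements chosen)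
-- he has built a chain of size m. WalkerWinsB likewise at Blocker's turn.
mutual
  data WalkerWinsW (d k m : ℕ) (h : List (Pt d)) : Set where
    end  : Complete d k h → BuildsChain m h → WalkerWinsW d k m h
    move : (x : Pt d) → InWedge k x → x ∉ h →
           WalkerWinsB d k m (h ∷ʳ x) → WalkerWinsW d k m h

  data WalkerWinsB (d k m : ℕ) (h : List (Pt d)) : Set where
    end  : Complete d k h → BuildsChain m h → WalkerWinsB d k m h
    move : ¬ Complete d k h →
           ((x : Pt d) → InWedge k x → x ∉ h → WalkerWinsW d k m (h ∷ʳ x)) →
           WalkerWinsB d k m h

WalkerCanBuild : (d k m : ℕ) → Set
WalkerCanBuild d k m = WalkerWinsW d k m []

module Submission where

-- Project the lattice of d-tuples to the triangular lattice so that twelve of the coordinate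
-- directions become the vectors 2u and u + u', where u' is the unit vector following u
-- counterclockwise.  A point taken by Blocker burns its projection, and Walker only steps onto
-- unburnt cells, in the manner of Kloster's angel of power 2: he keeps a region A, initially a
-- half plane, on his left and makes two cell-to-cell moves along its boundary per turn.  After
-- every burn A is enlarged, keeping the visited cells outside, so that
--     2 * (number of burnt cells in A) - (number of left turns of the boundary of A)
-- is maximal, ties being broken in favour of the larger region.
-- A burnt cell touching A would increase this value weakly when added, so the cells next to A are
-- unburnt.  Were Walker to return to a visited cell, he would have closed a loop; filling the pocket
-- enclosed by it removes all left turns of the loop, two per turn played, while Blocker has burnt
-- only one cell per turn.  This contradicts the maximality of A at the time the loop was started.
-- Finally a cell with three consecutive sides in A could be added for free, so the two moves of a
-- turn go straight on or bend left by 60 degrees: twelve displacements.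

open import Defs
open import Algebra.Bundles using (CommutativeRing)
open import Data.Bool using (Bool; true; false; not; _∧_; _∨_; _xor_)
import Data.Bool.Properties as 𝔹
open import Algebra.Properties.CommutativeSemigroup
  (CommutativeRing.+-commutativeSemigroup 𝔹.xor-∧-commutativeRing) using (interchange)
open import Data.Empty using (⊥; ⊥-elim)
open import Data.Integer as ℤ using (ℤ; +_; -[1+_])
import Data.Integer.Properties as ℤₚ
open import Algebra.Properties.AbelianGroup ℤₚ.+-0-abelianGroup
  using () renaming (∙-cancelʳ to +-cancelʳ)
open import Data.List
  using (List; []; _∷_; _++_; _∷ʳ_; length; map; filter; foldr; upTo; cartesianProduct; cartesianProductWith)
import Data.List.Properties as Listₚ
import Data.List.Membership.DecPropositional as DecMembership
open import Data.List.Membership.Propositional using (_∈_; _∉_; find; lose)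
open import Data.List.Membership.Propositional.Properties
open import Data.List.Relation.Binary.Sublist.Propositional
  using (_⊆_; []; _∷_; ⊆-refl; ⊆-trans; minimum)
open import Data.List.Relation.Unary.All as All using (All; []; _∷_)
import Data.List.Relation.Unary.All.Properties as Allₚ
open import Data.List.Relation.Unary.AllPairs using ([]; _∷_)
open import Data.List.Relation.Unary.Any as Any using (Any; here; there)
open import Data.List.Relation.Unary.Linked using (Linked; []; [-]; _∷_)
open import Data.List.Relation.Unary.Unique.Propositional using (Unique)
import Data.List.Relation.Unary.Unique.DecPropositional as UniqueDec
import Data.List.Relation.Unary.Unique.Propositional.Properties as Uniqueₚ
open import Data.Nat as ℕ using (ℕ; zero; suc; _+_; _*_; _≤_; _<_; z≤n; s≤s)
open import Data.Nat.DivMod using (_%_)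
open import Data.Nat.ListAction using (sum)
import Data.Nat.Properties as ℕₚ
open import Data.Nat.Tactic.RingSolver using (solve-∀)
open import Data.Product using (Σ; ∃; ∃₂; _×_; _,_; proj₁; proj₂)
open import Data.Product.Properties using (≡-dec)
open import Data.Sum using (_⊎_; inj₁; inj₂; [_,_])
open import Data.Vec as Vec using ([]; _∷_)
import Data.Vec.Properties as Vecₚ
open import Data.Vec.Relation.Binary.Pointwise.Inductive as Pointwise using ([]; _∷_)
open import Function using (_∘_; id; case_of_; mk⇔; _⟨_⟩_)
open import Relation.Binary.Definitions using (DecidableEquality; tri<; tri≈; tri>)
open import Relation.Binary.PropositionalEquality
  using (_≡_; _≢_; refl; sym; trans; cong; cong₂; subst; subst₂; module ≡-Reasoning)
open import Relation.Nullary using (¬_; Dec; yes; no; does)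
open import Relation.Nullary.Decidable
  using (map′; ¬?; _×-dec_; _→-dec_; from-yes; does-⇔; dec-true; dec-false)

-- Lattice cells and directions

unique-⊆-length : {A : Set} {xs ys : List A} → Unique xs →
  (∀ {x} → x ∈ xs → x ∈ ys) → length xs ≤ length ys
unique-⊆-length [] sub = z≤n
unique-⊆-length {xs = x ∷ xs} (x≢ ∷ u) sub with ∈-∃++ (sub (here refl))
... | as , bs , refl =
  subst (suc (length xs) ≤_) (sym (trans (Listₚ.length-++ as) (ℕₚ.+-suc _ _)))
    (s≤s (subst (length xs ≤_) (Listₚ.length-++ as) (unique-⊆-length u sub′)))
  where
  sub′ : ∀ {y} → y ∈ xs → y ∈ as ++ bs
  sub′ y∈ with ∈-++⁻ as (sub (there y∈))
  ... | inj₁ y∈as = ∈-++⁺ˡ y∈as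
  ... | inj₂ (here refl) = ⊥-elim (All.lookup x≢ y∈ refl)
  ... | inj₂ (there y∈bs) = ∈-++⁺ʳ as y∈bs

data Dir : Set where
  d0 d1 d2 d3 d4 d5 : Dir

infixl 30 _⁺ _⁻
_⁺ _⁻ : Dir → Dir
d0 ⁺ = d1
d1 ⁺ = d2
d2 ⁺ = d3
d3 ⁺ = d4
d4 ⁺ = d5
d5 ⁺ = d0
d0 ⁻ = d5
d1 ⁻ = d0
d2 ⁻ = d1
d3 ⁻ = d2
d4 ⁻ = d3
d5 ⁻ = d4

dirIndex : Dir → ℕ
dirIndex d0 = 0
dirIndex d1 = 1
dirIndex d2 = 2
dirIndex d3 = 3
dirIndex d4 = 4
dirIndex d5 = 5

dirAt : ℕ → Dir
dirAt 0 = d0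
dirAt 1 = d1
dirAt 2 = d2
dirAt 3 = d3
dirAt 4 = d4
dirAt _ = d5

dirAt-index : ∀ d → dirAt (dirIndex d) ≡ d
dirAt-index d0 = refl
dirAt-index d1 = refl
dirAt-index d2 = refl
dirAt-index d3 = refl
dirAt-index d4 = refl
dirAt-index d5 = refl

_≟ᵈ_ : DecidableEquality Dir
d ≟ᵈ e = map′ (λ eq → trans (sym (dirAt-index d)) (trans (cong dirAt eq) (dirAt-index e)))
              (cong dirIndex) (dirIndex d ℕ.≟ dirIndex e)

dirs : List Dir
dirs = d0 ∷ d1 ∷ d2 ∷ d3 ∷ d4 ∷ d5 ∷ []

∈-dirs : ∀ d → d ∈ dirs
∈-dirs d0 = here refl
∈-dirs d1 = there (here refl)
∈-dirs d2 = there (there (here refl))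
∈-dirs d3 = there (there (there (here refl)))
∈-dirs d4 = there (there (there (there (here refl))))
∈-dirs d5 = there (there (there (there (there (here refl)))))

∀dir? : {P : Dir → Set} → (∀ d → Dec (P d)) → Dec (∀ d → P d)
∀dir? P? = map′ (λ ps d → All.lookup ps (∈-dirs d)) (λ f → All.tabulate (λ {d} _ → f d))
                (All.all? P? dirs)

⁺⁻ : ∀ d → d ⁺ ⁻ ≡ d
⁺⁻ = from-yes (∀dir? λ d → d ⁺ ⁻ ≟ᵈ d)

⁻⁺ : ∀ d → d ⁻ ⁺ ≡ d
⁻⁺ = from-yes (∀dir? λ d → d ⁻ ⁺ ≟ᵈ d)

Cell : Set
Cell = ℤ × ℤ

_≟ᶜ_ : DecidableEquality Cell
_≟ᶜ_ = ≡-dec ℤ._≟_ ℤ._≟_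

dx dy : Dir → ℤ → ℤ
dx d0 = ℤ.suc
dx d1 = ℤ.suc
dx d2 = id
dx d3 = ℤ.pred
dx d4 = ℤ.pred
dx d5 = id
dy d0 = id
dy d1 = ℤ.suc
dy d2 = ℤ.suc
dy d3 = id
dy d4 = ℤ.pred
dy d5 = ℤ.pred

-- The triangular lattice in the basis where the six unit vectors, in
-- counterclockwise order, are (1,0), (1,1), (0,1), (-1,0), (-1,-1), (0,-1).
mv : Dir → Cell → Cell
mv d z = dx d (proj₁ z) , dy d (proj₂ z)

private
  sp = ℤₚ.suc-pred
  ps = ℤₚ.pred-suc

opp : Dir → Dir
opp d = d ⁺ ⁺ ⁺

mv-opp : ∀ d z → mv (opp d) (mv d z) ≡ z
mv-opp d0 (i , j) = cong₂ _,_ (ps i) refl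
mv-opp d1 (i , j) = cong₂ _,_ (ps i) (ps j)
mv-opp d2 (i , j) = cong₂ _,_ refl (ps j)
mv-opp d3 (i , j) = cong₂ _,_ (sp i) refl
mv-opp d4 (i , j) = cong₂ _,_ (sp i) (sp j)
mv-opp d5 (i , j) = cong₂ _,_ refl (sp j)

-- The two unit vectors a sixth of a turn to either side of `d` add up to that of `d`. Hence, after
-- a move in direction `k ⁻`, the wall cell that was seen in direction `k` is seen in direction
-- `k ⁺`.
mv-tri : ∀ d z → mv (d ⁺) (mv (d ⁻) z) ≡ mv d z
mv-tri d0 (i , j) = cong₂ _,_ refl (sp j)
mv-tri d1 (i , j) = refl
mv-tri d2 (i , j) = cong₂ _,_ (ps i) refl
mv-tri d3 (i , j) = cong₂ _,_ refl (ps j)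
mv-tri d4 (i , j) = refl
mv-tri d5 (i , j) = cong₂ _,_ (sp i) refl

mv-tri′ : ∀ d z → mv (d ⁻) (mv (d ⁺) z) ≡ mv d z
mv-tri′ d0 (i , j) = cong₂ _,_ refl (ps j)
mv-tri′ d1 (i , j) = refl
mv-tri′ d2 (i , j) = cong₂ _,_ (sp i) refl
mv-tri′ d3 (i , j) = cong₂ _,_ refl (sp j)
mv-tri′ d4 (i , j) = refl
mv-tri′ d5 (i , j) = cong₂ _,_ (ps i) refl

private
  suc≢ : ∀ {i} → ℤ.suc i ≢ i
  suc≢ {i} eq = ℤₚ.<-irrefl (sym eq) (ℤₚ.suc[i]≤j⇒i<j ℤₚ.≤-refl)
  pred≢ : ∀ {i} → ℤ.pred i ≢ i
  pred≢ {i} eq = suc≢ (trans (cong ℤ.suc (sym eq)) (sp i))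

mv≢ : ∀ d {z} → mv d z ≢ z
mv≢ d0 = suc≢ ∘ cong proj₁
mv≢ d1 = suc≢ ∘ cong proj₁
mv≢ d2 = suc≢ ∘ cong proj₂
mv≢ d3 = pred≢ ∘ cong proj₁
mv≢ d4 = pred≢ ∘ cong proj₁
mv≢ d5 = pred≢ ∘ cong proj₂

vx vy : Dir → ℤ
vx d0 = + 1
vx d1 = + 1
vx d2 = + 0
vx d3 = -[1+ 0 ]
vx d4 = -[1+ 0 ]
vx d5 = + 0
vy d0 = + 0
vy d1 = + 1
vy d2 = + 1
vy d3 = + 0
vy d4 = -[1+ 0 ]
vy d5 = -[1+ 0 ]

dx-+ : ∀ d i → dx d i ≡ vx d ℤ.+ i
dx-+ d0 i = refl
dx-+ d1 i = refl
dx-+ d2 i = sym (ℤₚ.+-identityˡ i)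
dx-+ d3 i = refl
dx-+ d4 i = refl
dx-+ d5 i = sym (ℤₚ.+-identityˡ i)

dy-+ : ∀ d i → dy d i ≡ vy d ℤ.+ i
dy-+ d0 i = sym (ℤₚ.+-identityˡ i)
dy-+ d1 i = refl
dy-+ d2 i = refl
dy-+ d3 i = sym (ℤₚ.+-identityˡ i)
dy-+ d4 i = refl
dy-+ d5 i = refl

private
  v-injective : ∀ d e → vx d ≡ vx e × vy d ≡ vy e → d ≡ e
  v-injective = from-yes (∀dir? λ d → ∀dir? λ e →
    ((vx d ℤ.≟ vx e) ×-dec (vy d ℤ.≟ vy e)) →-dec (d ≟ᵈ e))

mv-injectiveˡ : ∀ {d e} z → mv d z ≡ mv e z → d ≡ e
mv-injectiveˡ {d} {e} (i , j) eq = v-injective d e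
  ( +-cancelʳ i (vx d) (vx e) (trans (sym (dx-+ d i)) (trans (cong proj₁ eq) (dx-+ e i)))
  , +-cancelʳ j (vy d) (vy e) (trans (sym (dy-+ d j)) (trans (cong proj₂ eq) (dy-+ e j))))

ltᶻ eqᶻ : ℤ → ℤ → Bool
ltᶻ i j = does (i ℤ.<? j)
eqᶻ i j = does (i ℤ.≟ j)

<suc⇒≤ : ∀ {i j} → i ℤ.< ℤ.suc j → i ℤ.≤ j
<suc⇒≤ {i} {j} p = subst₂ ℤ._≤_ (ℤₚ.pred-suc i) (ℤₚ.pred-suc j) (ℤₚ.pred-mono (ℤₚ.i<j⇒suc[i]≤j p))

≤⇒<suc : ∀ {i j} → i ℤ.≤ j → i ℤ.< ℤ.suc j
≤⇒<suc p = ℤₚ.suc[i]≤j⇒i<j (ℤₚ.suc-mono p)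

lt-suc : ∀ y j → ltᶻ y (ℤ.suc j) ≡ ltᶻ y j xor eqᶻ y j
lt-suc y j with ℤₚ.<-cmp y j
... | tri< a ¬b _ rewrite dec-true (y ℤ.<? j) a | dec-false (y ℤ.≟ j) ¬b
                        | dec-true (y ℤ.<? ℤ.suc j) (≤⇒<suc (ℤₚ.<⇒≤ a)) = refl
... | tri≈ ¬a b _ rewrite dec-false (y ℤ.<? j) ¬a | dec-true (y ℤ.≟ j) b
                        | dec-true (y ℤ.<? ℤ.suc j) (≤⇒<suc (ℤₚ.≤-reflexive b)) = refl
... | tri> ¬a ¬b c rewrite dec-false (y ℤ.<? j) ¬a | dec-false (y ℤ.≟ j) ¬b
                        | dec-false (y ℤ.<? ℤ.suc j) (λ p → ℤₚ.<⇒≱ c (<suc⇒≤ p)) = refl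

suc-injective : ∀ {i j} → ℤ.suc i ≡ ℤ.suc j → i ≡ j
suc-injective {i} {j} e = trans (sym (ℤₚ.pred-suc i)) (trans (cong ℤ.pred e) (ℤₚ.pred-suc j))

lt-suc-suc : ∀ y j → ltᶻ (ℤ.suc y) (ℤ.suc j) ≡ ltᶻ y j
lt-suc-suc y j = does-⇔ (mk⇔ (λ p → ℤₚ.suc[i]≤j⇒i<j (<suc⇒≤ p)) (λ p → ≤⇒<suc (ℤₚ.i<j⇒suc[i]≤j p)))
                  (ℤ.suc y ℤ.<? ℤ.suc j) (y ℤ.<? j)

eq-suc-suc : ∀ y j → eqᶻ (ℤ.suc y) (ℤ.suc j) ≡ eqᶻ y j
eq-suc-suc y j = does-⇔ (mk⇔ suc-injective (cong ℤ.suc)) (ℤ.suc y ℤ.≟ ℤ.suc j) (y ℤ.≟ j)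

lt-pred : ∀ y j → ltᶻ (ℤ.pred y) j ≡ ltᶻ y (ℤ.suc j)
lt-pred y j = trans (sym (lt-suc-suc (ℤ.pred y) j)) (cong (λ i → ltᶻ i (ℤ.suc j)) (ℤₚ.suc-pred y))

eq-pred : ∀ y j → eqᶻ (ℤ.pred y) j ≡ eqᶻ y (ℤ.suc j)
eq-pred y j = trans (sym (eq-suc-suc (ℤ.pred y) j)) (cong (λ i → eqᶻ i (ℤ.suc j)) (ℤₚ.suc-pred y))

-- Crossing parity

data Axis : Set where
  a0 a1 a2 : Axis

axisDir : Axis → Dir
axisDir a0 = d0
axisDir a1 = d1
axisDir a2 = d2

Edge : Set
Edge = Cell × Axis

edge : Cell → Dir → Edge
edge r d0 = r , a0
edge r d1 = r , a1
edge r d2 = r , a2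
edge r d3 = mv d3 r , a0
edge r d4 = mv d4 r , a1
edge r d5 = mv d5 r , a2

-- The vertices of the hexagonal cells, i.e. the triangles z, z + (1,0), z + (1,1) (up) and
-- z, z + (1,1), z + (0,1) (down) of the lattice.
data Triangle : Set where
  up down : Cell → Triangle

-- Its lattice points are `r`, `mv k r` and `mv (k ⁺) r`. The side of the hexagon `r` facing
-- direction `k` therefore runs between `triangle r k` and `triangle r (k ⁻)`.
triangle : Cell → Dir → Triangle
triangle r d0 = up r
triangle r d1 = down r
triangle r d2 = up (mv d3 r)
triangle r d3 = down (mv d4 r)
triangle r d4 = up (mv d4 r)
triangle r d5 = down (mv d5 r)

-- Both are the triangle on `r`, `mv (k ⁻) r` and `mv k r`, the point where the boundary curve bends
-- when the runner moves on; so the curve stays connected across a move.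
triangle-pivot : ∀ r k → triangle (mv (k ⁻) r) (k ⁺) ≡ triangle r (k ⁻)
triangle-pivot (i , j) d0 = refl
triangle-pivot (i , j) d1 = cong (λ a → up (a , j)) (ℤₚ.pred-suc i)
triangle-pivot (i , j) d2 = cong₂ (λ a b → down (a , b)) (ℤₚ.pred-suc i) (ℤₚ.pred-suc j)
triangle-pivot (i , j) d3 = cong (λ b → up (ℤ.pred i , b)) (ℤₚ.pred-suc j)
triangle-pivot (i , j) d4 = refl
triangle-pivot (i , j) d5 = refl

-- Does the downward ray from z cross the given edge?
onRay : Edge → Cell → Bool
onRay (c , a0) z = false
onRay (c , a1) z = false
onRay (c , a2) z = eqᶻ (proj₁ c) (proj₁ z) ∧ ltᶻ (proj₂ c) (proj₂ z)

-- Does the triangle lie below the given edge, in the strip between the two downward rays from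
-- its ends?
inStrip : Edge → Triangle → Bool
inStrip (z , a0) (up c)   = eqᶻ (proj₁ c) (proj₁ z) ∧ ltᶻ (proj₂ c) (proj₂ z)
inStrip (z , a0) (down c) = eqᶻ (proj₁ c) (proj₁ z) ∧ ltᶻ (proj₂ c) (proj₂ z)
inStrip (z , a1) (up c)   = eqᶻ (proj₁ c) (proj₁ z) ∧ ltᶻ (proj₂ c) (ℤ.suc (proj₂ z))
inStrip (z , a1) (down c) = eqᶻ (proj₁ c) (proj₁ z) ∧ ltᶻ (proj₂ c) (proj₂ z)
inStrip (z , a2) _        = false

sameAxis : Axis → Axis → Bool
sameAxis a0 a0 = true
sameAxis a1 a1 = true
sameAxis a2 a2 = true
sameAxis _ _ = false

hit : Edge → Edge → Bool
hit ((i , j) , t) ((i′ , j′) , t′) = sameAxis t t′ ∧ (eqᶻ i i′ ∧ eqᶻ j j′)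

-- The end points of the hexagon side shared by the two cells which the edge joins.
dualEnds : Edge → Triangle × Triangle
dualEnds (c , a0) = down (mv d5 c) , up c
dualEnds (c , a1) = up c , down c
dualEnds (c , a2) = down c , up (mv d3 c)

private
  case0 : ∀ E l q → (E ∧ l) xor ((E ∧ (l xor q)) xor (E ∧ q)) ≡ false
  case0 false l q = refl
  case0 true false false = refl
  case0 true false true = refl
  case0 true true false = refl
  case0 true true true = refl

  case1 : ∀ E l q → E ∧ q ≡ (E ∧ (l xor q)) xor (E ∧ l)
  case1 false l q = refl
  case1 true false false = refl
  case1 true false true = refl
  case1 true true false = refl
  case1 true true true = refl

  xor-false : ∀ a b → a xor (b xor false) ≡ a xor b
  xor-false false false = refl
  xor-false false true = refl
  xor-false true false = refl
  xor-false true true = refl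

-- Summed along a closed chain of edges, the right-hand side telescopes.
ray-strip : ∀ e z t →
  onRay e z xor (onRay e (mv (axisDir t) z) xor hit e (z , t)) ≡
  inStrip (z , t) (proj₁ (dualEnds e)) xor inStrip (z , t) (proj₂ (dualEnds e))
ray-strip ((i , j) , a0) (i′ , j′) a0
  rewrite lt-pred j j′ | lt-suc j j′ = case1 (eqᶻ i i′) (ltᶻ j j′) (eqᶻ j j′)
ray-strip ((i , j) , a0) (i′ , j′) a1
  rewrite lt-pred j j′ = sym (𝔹.xor-same (eqᶻ i i′ ∧ ltᶻ j (ℤ.suc j′)))
ray-strip ((i , j) , a0) (i′ , j′) a2 = refl
ray-strip ((i , j) , a1) (i′ , j′) a0 = sym (𝔹.xor-same (eqᶻ i i′ ∧ ltᶻ j j′))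
ray-strip ((i , j) , a1) (i′ , j′) a1
  rewrite lt-suc j j′ = case1 (eqᶻ i i′) (ltᶻ j j′) (eqᶻ j j′)
ray-strip ((i , j) , a1) (i′ , j′) a2 = refl
ray-strip ((i , j) , a2) (i′ , j′) a0
  rewrite eq-pred i i′ = xor-false (eqᶻ i i′ ∧ ltᶻ j j′) _
ray-strip ((i , j) , a2) (i′ , j′) a1
  rewrite eq-pred i i′ = xor-false (eqᶻ i i′ ∧ ltᶻ j j′) _
ray-strip ((i , j) , a2) (i′ , j′) a2
  rewrite lt-suc j j′ = case0 (eqᶻ i i′) (ltᶻ j j′) (eqᶻ j j′)

ray-strip-dir : ∀ r k z t →
  onRay (edge r k) z xor (onRay (edge r k) (mv (axisDir t) z) xor hit (edge r k) (z , t)) ≡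
  inStrip (z , t) (triangle r k) xor inStrip (z , t) (triangle r (k ⁻))
ray-strip-dir r d0 z t = trans (ray-strip (edge r d0) z t) (𝔹.xor-comm _ (inStrip (z , t) (triangle r d0)))
ray-strip-dir r d1 z t = trans (ray-strip (edge r d1) z t) (𝔹.xor-comm _ (inStrip (z , t) (triangle r d1)))
ray-strip-dir r d2 z t = trans (ray-strip (edge r d2) z t) (𝔹.xor-comm _ (inStrip (z , t) (triangle r d2)))
ray-strip-dir r d3 z t = ray-strip (edge r d3) z t
ray-strip-dir r d4 z t = ray-strip (edge r d4) z t
ray-strip-dir r d5 z t = ray-strip (edge r d5) z t

ends : Edge → Cell × Cell
ends (z , t) = z , mv (axisDir t) z

hit-sound : ∀ e f → hit e f ≡ true → e ≡ f
hit-sound ((i , j) , t) ((i′ , j′) , t′) h with sameAxis t t′ in st | i ℤ.≟ i′ | j ℤ.≟ j′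
... | true | yes refl | yes refl = cong (_ ,_) (same t t′ st)
  where
  same : ∀ t t′ → sameAxis t t′ ≡ true → t ≡ t′
  same a0 a0 _ = refl
  same a1 a1 _ = refl
  same a2 a2 _ = refl

hit-self : ∀ e → hit e e ≡ true
hit-self ((i , j) , t) rewrite dec-true (i ℤ.≟ i) refl | dec-true (j ℤ.≟ j) refl = same t
  where
  same : ∀ t → sameAxis t t ∧ true ≡ true
  same a0 = refl
  same a1 = refl
  same a2 = refl

edge-ends : ∀ r k → ends (edge r k) ≡ (r , mv k r) ⊎ ends (edge r k) ≡ (mv k r , r)
edge-ends r d0 = inj₁ refl
edge-ends r d1 = inj₁ refl
edge-ends r d2 = inj₁ refl
edge-ends r d3 = inj₂ (cong (mv d3 r ,_) (mv-opp d3 r))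
edge-ends r d4 = inj₂ (cong (mv d4 r ,_) (mv-opp d4 r))
edge-ends r d5 = inj₂ (cong (mv d5 r ,_) (mv-opp d5 r))

edge-injective : ∀ {r k s l} → edge r k ≡ edge s l →
  (r ≡ s × mv k r ≡ mv l s) ⊎ (r ≡ mv l s × mv k r ≡ s)
edge-injective {r} {k} {s} {l} e with edge-ends r k | edge-ends s l
... | inj₁ p | inj₁ q = inj₁ (cong proj₁ pq , cong proj₂ pq) where pq = trans (sym p) (trans (cong ends e) q)
... | inj₁ p | inj₂ q = inj₂ (cong proj₁ pq , cong proj₂ pq) where pq = trans (sym p) (trans (cong ends e) q)
... | inj₂ p | inj₁ q = inj₂ (cong proj₂ pq , cong proj₁ pq) where pq = trans (sym p) (trans (cong ends e) q)
... | inj₂ p | inj₂ q = inj₁ (cong proj₂ pq , cong proj₁ pq) where pq = trans (sym p) (trans (cong ends e) q)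

State : Set
State = Cell × Dir

edgeOf : State → Edge
edgeOf (r , k) = edge r k

parity : {A : Set} → (A → Bool) → List A → Bool
parity f = foldr (λ a b → f a xor b) false

parity-++ : ∀ {A : Set} (f : A → Bool) xs ys → parity f (xs ++ ys) ≡ parity f xs xor parity f ys
parity-++ f [] ys = refl
parity-++ f (x ∷ xs) ys = trans (cong (f x xor_) (parity-++ f xs ys)) (sym (𝔹.xor-assoc (f x) _ _))

parity-false : ∀ {A : Set} {f : A → Bool} {xs} → All (λ a → f a ≡ false) xs → parity f xs ≡ false
parity-false [] = refl
parity-false (p ∷ ps) rewrite p = parity-false ps

-- Crossing parity of the downward ray with the curve made of the hexagon sides of the given states;
-- for a closed curve it distinguishes inside from outside.
winding : List State → Cell → Bool
winding es z = parity (λ e → onRay (edgeOf e) z) es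

-- The list is ordered newest first, so T is where the chain starts and T′ where it ends.
data Chain : Triangle → Triangle → List State → Set where
  []  : ∀ {T} → Chain T T []
  _∷_ : ∀ {T T′ r k es} → triangle r k ≡ T′ → Chain T T′ es →
        Chain T (triangle r (k ⁻)) ((r , k) ∷ es)

chain-strip : ∀ {T T′ es} → Chain T T′ es → ∀ z t →
  winding es z xor (winding es (mv (axisDir t) z) xor parity (λ e → hit (edgeOf e) (z , t)) es)
  ≡ inStrip (z , t) T xor inStrip (z , t) T′
chain-strip {T} [] z t = sym (𝔹.xor-same (inStrip (z , t) T))
chain-strip {T} (_∷_ {T′ = T′} {r} {k} {es} join c) z t = begin
  (a xor A) xor ((b xor B) xor (h xor H))
    ≡⟨ cong ((a xor A) xor_) (interchange b B h H) ⟩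
  (a xor A) xor ((b xor h) xor (B xor H))
    ≡⟨ interchange a A (b xor h) (B xor H) ⟩
  (a xor (b xor h)) xor (A xor (B xor H))
    ≡⟨ cong₂ _xor_ (ray-strip-dir r k z t) (chain-strip c z t) ⟩
  (σ (triangle r k) xor σ (triangle r (k ⁻))) xor (σ T xor σ T′)
    ≡⟨ cong (λ x → (σ x xor σ (triangle r (k ⁻))) xor (σ T xor σ T′)) join ⟩
  (σ T′ xor σ (triangle r (k ⁻))) xor (σ T xor σ T′)
    ≡⟨ cancel (σ T′) (σ (triangle r (k ⁻))) (σ T) ⟩
  σ T xor σ (triangle r (k ⁻)) ∎
  where
  open ≡-Reasoning
  σ = inStrip (z , t)
  z′ = mv (axisDir t) z
  a = onRay (edge r k) z
  A = winding es z
  b = onRay (edge r k) z′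
  B = winding es z′
  h = hit (edge r k) (z , t)
  H = parity (λ e → hit (edgeOf e) (z , t)) es
  cancel : ∀ p q s → (p xor q) xor (s xor p) ≡ s xor q
  cancel false q s = 𝔹.xor-comm q (s xor false) ⟨ trans ⟩ cong (_xor q) (𝔹.xor-identityʳ s)
  cancel true q s = trans (cong (not q xor_) (𝔹.xor-comm s true))
    (trans (lem q s) (𝔹.xor-comm q s))
    where
    lem : ∀ q s → not q xor not s ≡ q xor s
    lem false false = refl
    lem false true = refl
    lem true false = refl
    lem true true = refl

-- On a closed curve the two strip terms of `chain-strip` cancel, so the parity changes between
-- neighbours exactly when an odd number of sides of the curve separates them. Directions `d3`,
-- `d4`, `d5` follow by exchanging the two cells.
winding-jump : ∀ {T es} → Chain T T es → ∀ a d →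
  winding es a xor winding es (mv d a) ≡ parity (λ e → hit (edgeOf e) (edge a d)) es
winding-jump {T} {es} c a d = go d
  where
  zero-sum : ∀ x y p → x xor (y xor p) ≡ false → x xor y ≡ p
  zero-sum false false p e = sym e
  zero-sum false true true e = refl
  zero-sum true false true e = refl
  zero-sum true true false e = refl
  base : ∀ z t → winding es z xor winding es (mv (axisDir t) z) ≡ parity (λ e → hit (edgeOf e) (z , t)) es
  base z t = zero-sum (winding es z) _ _ (trans (chain-strip c z t) (𝔹.xor-same (inStrip (z , t) T)))
  back : ∀ t d → mv (axisDir t) (mv d a) ≡ a →
    winding es a xor winding es (mv d a) ≡ parity (λ e → hit (edgeOf e) (mv d a , t)) es
  back t d e = trans (𝔹.xor-comm (winding es a) _)
    (trans (cong (λ y → winding es (mv d a) xor winding es y) (sym e)) (base (mv d a) t))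
  go : ∀ d → winding es a xor winding es (mv d a) ≡ parity (λ e → hit (edgeOf e) (edge a d)) es
  go d0 = base a a0
  go d1 = base a a1
  go d2 = base a a2
  go d3 = back a0 d3 (mv-opp d3 a)
  go d4 = back a1 d4 (mv-opp d4 a)
  go d5 = back a2 d5 (mv-opp d5 a)

Region : Set
Region = Cell → Bool

record Near (M : ℕ) (z : Cell) : Set where
  constructor near
  field
    ∣x∣≤ : ℤ.∣ proj₁ z ∣ ℕ.≤ M
    ∣y∣≤ : ℤ.∣ proj₂ z ∣ ℕ.≤ M
open Near public

-- Walking along the wall

-- A state (r , k) is a runner at the cell r outside the wall whose left-hand neighbour mv k r lies
-- in the wall.  The cell ahead is mv (k ⁻) r: if it belongs to the wall the runner turns on the spot,
-- otherwise he goes there.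
data Trail : Cell → Dir → Set where
  start : ∀ r k → Trail r k
  turn  : ∀ {r k} → Trail r k → Trail r (k ⁻)
  go    : ∀ {r k} → Trail r k → Trail (mv (k ⁻) r) (k ⁺)

states : ∀ {r k} → Trail r k → List State
states (start r k) = (r , k) ∷ []
states (turn {r} {k} T) = (r , k ⁻) ∷ states T
states (go {r} {k} T) = (mv (k ⁻) r , k ⁺) ∷ states T

cells : ∀ {r k} → Trail r k → List Cell
cells (start r k) = r ∷ []
cells (turn T) = cells T
cells (go {r} {k} T) = mv (k ⁻) r ∷ cells T

origin : ∀ {r k} → Trail r k → Cell
origin (start r k) = mv k r
origin (turn T) = origin T
origin (go T) = origin T

OnWall : Region → State → Set
OnWall A (r , k) = A r ≡ false × A (mv k r) ≡ true

current∈states : ∀ {r k} (T : Trail r k) → (r , k) ∈ states T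
current∈states (start r k) = here refl
current∈states (turn T) = here refl
current∈states (go T) = here refl

current∈cells : ∀ {r k} (T : Trail r k) → r ∈ cells T
current∈cells (start r k) = here refl
current∈cells (turn T) = current∈cells T
current∈cells (go T) = here refl

cell⇒state : ∀ {r k v} (T : Trail r k) → v ∈ cells T → ∃ λ l → (v , l) ∈ states T
cell⇒state (start r k) (here refl) = k , here refl
cell⇒state (turn T) v∈ = let l , p = cell⇒state T v∈ in l , there p
cell⇒state (go T) (here refl) = _ , here refl
cell⇒state (go T) (there v∈) = let l , p = cell⇒state T v∈ in l , there p

state⇒cell : ∀ {r k v l} (T : Trail r k) → (v , l) ∈ states T → v ∈ cells T
state⇒cell (start r k) (here refl) = here refl
state⇒cell (turn T) (here refl) = current∈cells T
state⇒cell (turn T) (there p) = state⇒cell T p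
state⇒cell (go T) (here refl) = here refl
state⇒cell (go T) (there p) = there (state⇒cell T p)

-- A `go` keeps the wall cell on the left and a `turn` replaces it by an adjacent wall cell, so the
-- left-hand cells are joined to `origin` by a path within the wall.
lefts-connected : ∀ {A r k} (T : Trail r k) (P : Cell → Set) →
  (∀ a d → A a ≡ true → A (mv d a) ≡ true → P a → P (mv d a)) → P (origin T) →
  All (OnWall A) (states T) → All (λ s → P (mv (proj₂ s) (proj₁ s))) (states T)
lefts-connected (start r k) P step p0 w = p0 ∷ []
lefts-connected {A} (turn {r} {k} T) P step p0 ((_ , l∈) ∷ w) =
  subst P eq (step (mv k r) (k ⁻ ⁻) (proj₂ (All.lookup w (current∈states T)))
    (subst (λ c → A c ≡ true) (sym eq) l∈) (All.lookup ih (current∈states T))) ∷ ih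
  where
  ih = lefts-connected T P step p0 w
  eq : mv (k ⁻ ⁻) (mv k r) ≡ mv (k ⁻) r
  eq = trans (cong (λ d → mv (k ⁻ ⁻) (mv d r)) (sym (⁻⁺ k))) (mv-tri′ (k ⁻) r)
lefts-connected (go {r} {k} T) P step p0 (_ ∷ w) =
  subst P (sym (mv-tri k r)) (All.lookup ih (current∈states T)) ∷ ih
  where ih = lefts-connected T P step p0 w

-- The part of a trail after its last visit to x, which was left at direction ε.
data Arc (x : Cell) (ε : Dir) : Cell → Dir → Set where
  leave : Arc x ε (mv (ε ⁻) x) (ε ⁺)
  turn  : ∀ {r k} → Arc x ε r k → Arc x ε r (k ⁻)
  go    : ∀ {r k} → Arc x ε r k → Arc x ε (mv (k ⁻) r) (k ⁺)

module _ {x : Cell} {ε : Dir} where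
  arcStates : ∀ {r k} → Arc x ε r k → List State
  arcStates leave = (mv (ε ⁻) x , ε ⁺) ∷ []
  arcStates (turn {r} {k} a) = (r , k ⁻) ∷ arcStates a
  arcStates (go {r} {k} a) = (mv (k ⁻) r , k ⁺) ∷ arcStates a

  arcCells : ∀ {r k} → Arc x ε r k → List Cell
  arcCells leave = mv (ε ⁻) x ∷ []
  arcCells (turn a) = arcCells a
  arcCells (go {r} {k} a) = mv (k ⁻) r ∷ arcCells a

  -- The moves of the arc, each recorded as the cell left and the direction taken. In this form
  -- every move is a left turn in the sense of `corner`, since the wall cell on the left touches
  -- both of its cells.
  exits : ∀ {r k} → Arc x ε r k → List State
  exits leave = (x , ε ⁻) ∷ []
  exits (turn a) = exits a
  exits (go {r} {k} a) = (r , k ⁻) ∷ exits a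

  exits-cells : ∀ {r k} (a : Arc x ε r k) → r ∷ map proj₁ (exits a) ≡ arcCells a ++ x ∷ []
  exits-cells leave = refl
  exits-cells (turn a) = exits-cells a
  exits-cells (go {r} {k} a) = cong (mv (k ⁻) r ∷_) (exits-cells a)

  arc-chain : ∀ {r k} (a : Arc x ε r k) →
    Chain (triangle x (ε ⁻)) (triangle r (k ⁻)) (arcStates a)
  arc-chain leave = triangle-pivot x ε ∷ []
  arc-chain (turn a) = refl ∷ arc-chain a
  arc-chain (go {r} {k} a) = triangle-pivot r k ∷ arc-chain a

  arc-current∈cells : ∀ {r k} (a : Arc x ε r k) → r ∈ arcCells a
  arc-current∈cells leave = here refl
  arc-current∈cells (turn a) = arc-current∈cells a
  arc-current∈cells (go a) = here refl

  arc-current∈states : ∀ {r k} (a : Arc x ε r k) → (r , k) ∈ arcStates a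
  arc-current∈states leave = here refl
  arc-current∈states (turn a) = here refl
  arc-current∈states (go a) = here refl

  arcState⇒cell : ∀ {r k v l} (a : Arc x ε r k) → (v , l) ∈ arcStates a → v ∈ arcCells a
  arcState⇒cell leave (here refl) = here refl
  arcState⇒cell (turn a) (here refl) = arc-current∈cells a
  arcState⇒cell (turn a) (there p) = arcState⇒cell a p
  arcState⇒cell (go a) (here refl) = here refl
  arcState⇒cell (go a) (there p) = there (arcState⇒cell a p)

record Split {r k} (T : Trail r k) (x : Cell) : Set where
  constructor split
  field
    {exitDir}  : Dir
    arc        : Arc x exitDir r k
    olderCells : List Cell
    olderStates : List State
    cells-eq   : cells T ≡ arcCells arc ++ x ∷ olderCells
    states-eq  : states T ≡ arcStates arc ++ (x , exitDir) ∷ olderStates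

tail-states : ∀ {r k} (T : Trail r k) → ∃ λ ss → states T ≡ (r , k) ∷ ss
tail-states (start r k) = _ , refl
tail-states (turn T) = _ , refl
tail-states (go T) = _ , refl

tail-cells : ∀ {r k} (T : Trail r k) → ∃ λ cs → cells T ≡ r ∷ cs
tail-cells (start r k) = _ , refl
tail-cells (turn T) = tail-cells T
tail-cells (go T) = _ , refl

splitAt : ∀ {r k x} (T : Trail r k) → x ∈ cells T → r ≢ x → Split T x
splitAt (start r k) (here refl) r≢x = ⊥-elim (r≢x refl)
splitAt (turn {r} {k} T) x∈ r≢x with splitAt T x∈ r≢x
... | split a oc os ce se = split (turn a) oc os ce (cong ((r , k ⁻) ∷_) se)
splitAt (go T) (here refl) r≢x = ⊥-elim (r≢x refl)
splitAt {x = x} (go {r} {k} T) (there x∈) _ with r ≟ᶜ x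
... | no r≢x with splitAt T x∈ r≢x
...   | split a oc os ce se = split (go a) oc os (cong (_ ∷_) ce) (cong (_ ∷_) se)
splitAt {x = x} (go {r} {k} T) (there x∈) _ | yes refl =
  split leave _ _ (cong (_ ∷_) (proj₂ (tail-cells T))) (cong (_ ∷_) (proj₂ (tail-states T)))

-- Closing a loop and filling its pocket

infixl 30 _⊝_
_⊝_ : Dir → ℕ → Dir
κ ⊝ zero = κ
κ ⊝ suc n = (κ ⊝ n) ⁻

sweep : ℕ → Dir → List Dir
sweep zero κ = κ ∷ []
sweep (suc n) κ = κ ⊝ suc n ∷ sweep n κ

-- The number of clockwise steps from `κ` to `ε`; the added 6 keeps the truncated subtraction exact.
turns : Dir → Dir → ℕ
turns κ ε = (6 ℕ.+ dirIndex κ ℕ.∸ dirIndex ε) % 6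

turns-end : ∀ κ ε → κ ⊝ turns κ ε ≡ ε
turns-end = from-yes (∀dir? λ κ → ∀dir? λ ε → (κ ⊝ turns κ ε) ≟ᵈ ε)

-- At most five steps are made, so no direction recurs and the last one is met once.
sweep-end-odd : ∀ κ ε → parity (λ d → does (d ≟ᵈ ε)) (sweep (turns κ ε) κ) ≡ true
sweep-end-odd = from-yes (∀dir? λ κ → ∀dir? λ ε →
  parity (λ d → does (d ≟ᵈ ε)) (sweep (turns κ ε) κ) 𝔹.≟ true)

-- The clockwise rotation stops at `ε`, one step short of `ε ⁻`, and so could meet `ε ⁻` only at its
-- start.
sweep-avoids : ∀ κ ε → κ ≢ ε ⁻ → All (_≢ ε ⁻) (sweep (turns κ ε) κ)
sweep-avoids = from-yes (∀dir? λ κ → ∀dir? λ ε →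
  ¬? (κ ≟ᵈ ε ⁻) →-dec All.all? (λ d → ¬? (d ≟ᵈ ε ⁻)) (sweep (turns κ ε) κ))

sweep-chain : ∀ {T es} x κ n → Chain T (triangle x κ) es →
  Chain T (triangle x ((κ ⊝ n) ⁻)) (map (x ,_) (sweep n κ) ++ es)
sweep-chain x κ zero c = refl ∷ c
sweep-chain x κ (suc n) c = refl ∷ sweep-chain x κ n c

false≢true : ∀ {b} → b ≡ false → b ≢ true
false≢true refl ()

-- The left turns of the boundary.
corner : Region → State → Bool
corner A (c , e) = not (A c) ∧ not (A (mv e c)) ∧ A (mv (e ⁺) c)

corner⁺ : ∀ {A c e} → A c ≡ false → A (mv e c) ≡ false → A (mv (e ⁺) c) ≡ true →
  corner A (c , e) ≡ true
corner⁺ p q r rewrite p | q | r = refl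

corner⁻ : ∀ {A c e} → corner A (c , e) ≡ true →
  A c ≡ false × A (mv e c) ≡ false × A (mv (e ⁺) c) ≡ true
corner⁻ {A} {c} {e} h with A c | A (mv e c) | A (mv (e ⁺) c)
... | false | false | true = refl , refl , refl

++⁻ʳ-disjoint : ∀ {xs ys : List Cell} {v} → Unique (xs ++ ys) → v ∈ xs → v ∉ ys
++⁻ʳ-disjoint (≢s ∷ u) (here refl) v∈ys = All.lookup ≢s (∈-++⁺ʳ _ v∈ys) refl
++⁻ʳ-disjoint (_ ∷ u) (there v∈xs) = ++⁻ʳ-disjoint u v∈xs

-- The situation to be refuted: a runner who has never repeated a cell is about to step onto the old
-- cell `x`. Filling what the loop encloses will destroy one left turn per move of the loop and
-- create none.
module Loop (A : Region) {r k} (T : Trail r k)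
  (wall : All (OnWall A) (states T)) (uniq : Unique (cells T))
  (below : ∀ z → proj₂ z ℤ.< + 0 → A z ≡ true) (origin-below : proj₂ (origin T) ℤ.< + 0)
  (x∈ : mv (k ⁻) r ∈ cells T) where

  x : Cell
  x = mv (k ⁻) r

  open Split (splitAt T x∈ (mv≢ (k ⁻) ∘ sym)) public renaming (exitDir to ε)

  uniq′ : Unique (arcCells arc ++ x ∷ olderCells)
  uniq′ = subst Unique cells-eq uniq

  wall′ : All (OnWall A) (arcStates arc ++ (x , ε) ∷ olderStates)
  wall′ = subst (All (OnWall A)) states-eq wall

  arc-wall : All (OnWall A) (arcStates arc)
  arc-wall = Allₚ.++⁻ˡ (arcStates arc) wall′

  exit-wall : OnWall A (x , ε)
  exit-wall = All.head (Allₚ.++⁻ʳ (arcStates arc) wall′)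

  x∉A : A x ≡ false
  x∉A = proj₁ exit-wall

  cur-wall : OnWall A (r , k)
  cur-wall = All.lookup wall (current∈states T)

  n : ℕ
  n = turns (k ⁺) ε

  -- The arc is closed by rotating around x; this affects the winding parity at x only.
  closing : List State
  closing = map (x ,_) (sweep n (k ⁺))

  Γ : List State
  Γ = closing ++ arcStates arc

  closed : Chain (triangle x (ε ⁻)) (triangle x (ε ⁻)) Γ
  closed = subst (λ d → Chain (triangle x (ε ⁻)) (triangle x (d ⁻)) Γ) (turns-end (k ⁺) ε)
    (sweep-chain x (k ⁺) n
      (subst (λ t → Chain (triangle x (ε ⁻)) t (arcStates arc)) (sym (triangle-pivot r k))
        (arc-chain arc)))

  w : Cell → Bool
  w = winding Γ

  ∈Γ⁻ : ∀ {s} → s ∈ Γ → s ∈ arcStates arc ⊎ ∃ λ d → d ∈ sweep n (k ⁺) × s ≡ (x , d)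
  ∈Γ⁻ s∈ with ∈-++⁻ closing s∈
  ... | inj₁ p = inj₂ (∈-map⁻ (x ,_) p)
  ... | inj₂ p = inj₁ p

  ∈Γ⇒∉A : ∀ {s} → s ∈ Γ → A (proj₁ s) ≡ false
  ∈Γ⇒∉A s∈ with ∈Γ⁻ s∈
  ... | inj₁ p = proj₁ (All.lookup arc-wall p)
  ... | inj₂ (d , _ , refl) = x∉A

  ∈Γ⇒cell : ∀ {s} → s ∈ Γ → proj₁ s ∈ cells T
  ∈Γ⇒cell s∈ with ∈Γ⁻ s∈
  ... | inj₁ p = subst (_ ∈_) (sym cells-eq) (∈-++⁺ˡ (arcState⇒cell arc p))
  ... | inj₂ (d , _ , refl) = x∈

  no-jump : ∀ a d → (∀ {s} → s ∈ Γ → edgeOf s ≢ edge a d) → w a ≡ w (mv d a)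
  no-jump a d miss = xor≡false (trans (winding-jump closed a d) (parity-false
    (All.tabulate λ {s} s∈ → 𝔹.¬-not λ h → miss s∈ (hit-sound (edgeOf s) (edge a d) h))))
    where
    xor≡false : ∀ {p q} → p xor q ≡ false → p ≡ q
    xor≡false {false} {false} _ = refl
    xor≡false {true} {true} _ = refl

  -- Every state of `Γ` sits at a cell outside the wall, so no side of `Γ` lies between two wall
  -- cells.
  inside-wall : ∀ a d → A a ≡ true → A (mv d a) ≡ true → w a ≡ w (mv d a)
  inside-wall a d p q = no-jump a d λ s∈ eq → case edge-injective eq of λ where
    (inj₁ (refl , _)) → false≢true (∈Γ⇒∉A s∈) p
    (inj₂ (refl , _)) → false≢true (∈Γ⇒∉A s∈) q

  -- A side from the arc borders a wall cell and a side from the closing rotation borders `x`.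
  outside-wall : ∀ a d → A a ≡ false → A (mv d a) ≡ false → a ≢ x → mv d a ≢ x → w a ≡ w (mv d a)
  outside-wall a d p q a≢ b≢ = no-jump a d λ s∈ eq → case ∈Γ⁻ s∈ , edge-injective eq of λ where
    (inj₁ s∈arc , inj₁ (_ , e)) → false≢true q (trans (cong A (sym e)) (proj₂ (All.lookup arc-wall s∈arc)))
    (inj₁ s∈arc , inj₂ (_ , e)) → false≢true p (trans (cong A (sym e)) (proj₂ (All.lookup arc-wall s∈arc)))
    (inj₂ (_ , _ , refl) , inj₁ (e , _)) → a≢ (sym e)
    (inj₂ (_ , _ , refl) , inj₂ (e , _)) → b≢ (sym e)

  older-wall : ∀ v d → A v ≡ false → A (mv d v) ≡ true → v ∉ arcCells arc → v ≢ x → w v ≡ w (mv d v)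
  older-wall v d p q v∉ v≢ = no-jump v d λ s∈ eq → case ∈Γ⁻ s∈ , edge-injective eq of λ where
    (inj₁ s∈arc , inj₁ (refl , _)) → v∉ (arcState⇒cell arc s∈arc)
    (inj₁ s∈arc , inj₂ (refl , _)) → false≢true (proj₁ (All.lookup arc-wall s∈arc)) q
    (inj₂ (_ , _ , refl) , inj₁ (e , _)) → v≢ (sym e)
    (inj₂ (_ , _ , refl) , inj₂ (e , _)) → false≢true x∉A (trans (cong A e) q)

  -- A side of `Γ` met by this ray would belong to a runner standing below row 0, that is, inside
  -- the wall.
  w-below : ∀ z → proj₂ z ℤ.< + 0 → w z ≡ false
  w-below z z<0 = parity-false (All.tabulate λ {s} s∈ → ray s s∈)
    where
    onRay-false : ∀ c → (proj₂ c ℤ.< proj₂ z → ⊥) → onRay (c , a2) z ≡ false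
    onRay-false c ¬p rewrite dec-false (proj₂ c ℤ.<? proj₂ z) ¬p = 𝔹.∧-zeroʳ _
    ray : ∀ s → s ∈ Γ → onRay (edgeOf s) z ≡ false
    ray (v , d0) s∈ = refl
    ray (v , d1) s∈ = refl
    ray (v , d2) s∈ = onRay-false v λ lt → false≢true (∈Γ⇒∉A s∈) (below v (ℤₚ.<-trans lt z<0))
    ray (v , d3) s∈ = refl
    ray (v , d4) s∈ = refl
    ray (v , d5) s∈ = onRay-false (mv d5 v) λ lt → false≢true (∈Γ⇒∉A s∈) (below v
      (ℤₚ.≤-<-trans (subst (ℤ._≤ proj₂ z) (ℤₚ.suc-pred (proj₂ v)) (ℤₚ.i<j⇒suc[i]≤j lt)) z<0))

  -- The wall connects each left-hand cell to `origin`, which lies outside `Γ`, and `Γ` does not cut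
  -- the wall.
  lefts : All (λ s → w (mv (proj₂ s) (proj₁ s)) ≡ false) (states T)
  lefts = lefts-connected {A} T (λ c → w c ≡ false)
    (λ a d p q e → trans (sym (inside-wall a d p q)) e) (w-below (origin T) origin-below) wall

  exit∈states : (x , ε) ∈ states T
  exit∈states = subst ((x , ε) ∈_) (sym states-eq) (∈-++⁺ʳ (arcStates arc) (here refl))

  -- Seen from `x`, direction `k ⁺` shows the wall cell on the left of `r`, whereas `ε ⁻` shows the
  -- unwalled cell to which the runner went after `x`.
  k⁺≢ε⁻ : k ⁺ ≢ ε ⁻
  k⁺≢ε⁻ e = false≢true next∉A (trans (cong A (trans (cong (λ d → mv d x) (sym e)) (mv-tri k r))) (proj₂ cur-wall))
    where
    first : ∀ {r k} (a : Arc x ε r k) → All (OnWall A) (arcStates a) → A (mv (ε ⁻) x) ≡ false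
    first leave (p ∷ _) = proj₁ p
    first (turn a) (_ ∷ ps) = first a ps
    first (go a) (_ ∷ ps) = first a ps
    next∉A : A (mv (ε ⁻) x) ≡ false
    next∉A = first arc arc-wall

  -- Among the edges of Γ, only the exit edge of x separates x from the wall cell on its left.
  w-x : w x ≡ true
  w-x = trans (sym (𝔹.xor-identityʳ (w x))) (trans (cong (w x xor_) (sym (All.lookup lefts exit∈states)))
    (trans (winding-jump closed x ε) (trans (parity-++ h closing (arcStates arc))
      (trans (cong (parity h closing xor_) (parity-false (All.tabulate λ {s} s∈ → 𝔹.¬-not λ e → miss s s∈ e)))
        (trans (𝔹.xor-identityʳ _) (trans (count (sweep n (k ⁺))) (sweep-end-odd (k ⁺) ε)))))))
    where
    h : State → Bool
    h s = hit (edgeOf s) (edge x ε)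
    miss : ∀ s → s ∈ arcStates arc → h s ≢ true
    miss s s∈ e with edge-injective (hit-sound (edgeOf s) (edge x ε) e)
    ... | inj₁ (refl , _) = ++⁻ʳ-disjoint uniq′ (arcState⇒cell arc s∈) (here refl)
    ... | inj₂ (refl , _) = false≢true (proj₁ (All.lookup arc-wall s∈)) (proj₂ exit-wall)
    same : ∀ d → h (x , d) ≡ does (d ≟ᵈ ε)
    same d = case d ≟ᵈ ε of λ where
      (yes p) → trans (cong (λ e → hit (edge x e) (edge x ε)) p)
        (trans (hit-self (edge x ε)) (sym (dec-true (d ≟ᵈ ε) p)))
      (no d≢ε) → trans
        (𝔹.¬-not λ e → case edge-injective (hit-sound (edge x d) (edge x ε) e) of λ where
          (inj₁ (_ , q)) → d≢ε (mv-injectiveˡ x q)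
          (inj₂ (q , _)) → mv≢ ε (sym q))
        (sym (dec-false (d ≟ᵈ ε) d≢ε))
    count : ∀ ds → parity h (map (x ,_) ds) ≡ parity (λ d → does (d ≟ᵈ ε)) ds
    count [] = refl
    count (d ∷ ds) = cong₂ _xor_ (same d) (count ds)

  -- The closing rotation does not pass direction `ε ⁻`, so the first cell after `x` lies on the
  -- same side of `Γ` as `x`.
  w-first : A (mv (ε ⁻) x) ≡ false → w (mv (ε ⁻) x) ≡ true
  w-first next∉A = trans (sym (no-jump x (ε ⁻) miss)) w-x
    where
    miss : ∀ {s} → s ∈ Γ → edgeOf s ≢ edge x (ε ⁻)
    miss s∈ eq with ∈Γ⁻ s∈ | edge-injective eq
    ... | inj₁ s∈arc | inj₁ (_ , e) = false≢true next∉A (trans (cong A (sym e)) (proj₂ (All.lookup arc-wall s∈arc)))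
    ... | inj₁ s∈arc | inj₂ (_ , e) = false≢true x∉A (trans (cong A (sym e)) (proj₂ (All.lookup arc-wall s∈arc)))
    ... | inj₂ (d , d∈ , refl) | inj₁ (_ , e) =
      All.lookup (sweep-avoids (k ⁺) ε k⁺≢ε⁻) d∈ (mv-injectiveˡ x e)
    ... | inj₂ (_ , _ , refl) | inj₂ (e , _) = mv≢ (ε ⁻) (sym e)

  -- Consecutive arc cells are neighbours outside the wall and different from `x`, so `outside-wall`
  -- carries the parity along from the first one.
  w-arc : ∀ {r k} (a : Arc x ε r k) → All (OnWall A) (arcStates a) → x ∉ arcCells a →
    w r ≡ true × All (λ v → w v ≡ true) (arcCells a)
  w-arc leave ((p , _) ∷ _) x∉ = w-first p , w-first p ∷ []
  w-arc (turn a) (_ ∷ ps) x∉ = w-arc a ps x∉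
  w-arc (go {r} {k} a) ((p , _) ∷ ps) x∉ =
    let wr , ws = w-arc a ps (x∉ ∘ there)
        q = trans (sym (outside-wall r (k ⁻) (proj₁ (All.lookup ps (arc-current∈states a))) p
              (λ e → x∉ (there (subst (_∈ arcCells a) e (arc-current∈cells a))))
              (λ e → x∉ (here (sym e))))) wr
    in q , q ∷ ws

  -- The cells enclosed by the loop, except for x: a region added at the time when x was the
  -- current cell must not contain x.
  pocket : Region
  pocket z = w z ∧ not (A z) ∧ not (does (z ≟ᶜ x))

  pocket⁻ : ∀ z → pocket z ≡ true → w z ≡ true × A z ≡ false × z ≢ x
  pocket⁻ z e with w z | A z | z ≟ᶜ x
  ... | true | false | no z≢x = refl , refl , z≢x

  pocket⁺ : ∀ z → w z ≡ true → A z ≡ false → z ≢ x → pocket z ≡ true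
  pocket⁺ z p q z≢x rewrite p | q | dec-false (z ≟ᶜ x) z≢x = refl

  filled : Region
  filled z = A z ∨ pocket z

  A⊆filled : ∀ z → A z ≡ true → filled z ≡ true
  A⊆filled z p rewrite p = refl

  pocket⊆filled : ∀ z → pocket z ≡ true → filled z ≡ true
  pocket⊆filled z p rewrite p = 𝔹.∨-zeroʳ (A z)

  filled⁻ : ∀ {z} → filled z ≡ true → A z ≡ true ⊎ pocket z ≡ true
  filled⁻ {z} p with A z
  ... | true = inj₁ refl
  ... | false = inj₂ p

  ∉filled : ∀ {z} → A z ≡ false → pocket z ≡ false → filled z ≡ false
  ∉filled p q rewrite p | q = refl

  ∉filled⇒∉A : ∀ {z} → filled z ≡ false → A z ≡ false
  ∉filled⇒∉A {z} p with A z
  ... | false = refl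

  x∉arc : x ∉ arcCells arc
  x∉arc x∈arc = ++⁻ʳ-disjoint uniq′ x∈arc (here refl)

  arc⊆pocket : ∀ {v} → v ∈ arcCells arc → pocket v ≡ true
  arc⊆pocket {v} v∈ = pocket⁺ v (All.lookup (proj₂ (w-arc arc arc-wall x∉arc)) v∈)
    (let l , p = cell⇒state T (subst (v ∈_) (sym cells-eq) (∈-++⁺ˡ v∈)) in proj₁ (All.lookup wall p))
    λ { refl → x∉arc v∈ }

  -- `Γ` does not separate an older cell from the wall cell on its left, which is outside; `x` is
  -- excluded from the pocket by definition.
  older∉filled : ∀ {v} → v ∈ x ∷ olderCells → filled v ≡ false
  older∉filled {v} v∈ = ∉filled v∉A (𝔹.¬-not λ p →
    let wv , _ , v≢x = pocket⁻ v p in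
    false≢true (trans (older-wall v l v∉A (proj₂ (All.lookup wall st)) v∉arc v≢x) (All.lookup lefts st)) wv)
    where
    v∈T = subst (v ∈_) (sym cells-eq) (∈-++⁺ʳ (arcCells arc) v∈)
    l = proj₁ (cell⇒state T v∈T)
    st = proj₂ (cell⇒state T v∈T)
    v∉A = proj₁ (All.lookup wall st)
    v∉arc : v ∉ arcCells arc
    v∉arc v∈arc = ++⁻ʳ-disjoint uniq′ v∈arc v∈

  -- If the inner cell of a left turn lay in the pocket, both outer cells would be unfilled
  -- neighbours of a pocket cell. By `outside-wall` only `x` can be one, but the outer cells are
  -- distinct.
  corner-filled : ∀ {s} → corner filled s ≡ true → corner A s ≡ true
  corner-filled {c , e} h with corner⁻ {filled} {c} {e} h
  ... | p , q , t with filled⁻ t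
  ...   | inj₁ a∈A = corner⁺ {A} {c} {e} (∉filled⇒∉A p) (∉filled⇒∉A q) a∈A
  ...   | inj₂ a∈K = ⊥-elim (mv≢ e (trans (is-x (mv e c) (e ⁺ ⁺) q eq) (sym (is-x c (e ⁺) p refl))))
    where
    a = mv (e ⁺) c
    eq : mv (e ⁺ ⁺) (mv e c) ≡ a
    eq = trans (cong (λ d → mv (e ⁺ ⁺) (mv d c)) (sym (⁺⁻ e))) (mv-tri (e ⁺) c)
    is-x : ∀ b d → filled b ≡ false → mv d b ≡ a → b ≡ x
    is-x b d b∉ eq = case b ≟ᶜ x of λ where
     (yes b≡x) → b≡x
     (no b≢x) →
      let wa , a∉A , a≢x = pocket⁻ a a∈K
          b∉A = ∉filled⇒∉A b∉
          wb = trans (outside-wall b d b∉A (trans (cong A eq) a∉A) b≢x (a≢x ∘ trans (sym eq))) (trans (cong w eq) wa)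
      in ⊥-elim (false≢true b∉ (pocket⊆filled b (pocket⁺ b wb b∉A b≢x)))

  allExits : List State
  allExits = (r , k ⁻) ∷ exits arc

  allExits-cells : map proj₁ allExits ≡ arcCells arc ++ x ∷ []
  allExits-cells = exits-cells arc

  -- A left turn disappears once one of its outer cells is filled: for the move out of `x` this is
  -- the cell entered, for all others the cell left.
  exit-corner : All (λ s → corner A s ≡ true × corner filled s ≡ false) allExits
  exit-corner = (exit r k cur-wall x∉A , lost₁ (r , k ⁻) (arc-current∈cells arc)) ∷ go′ arc arc-wall id
    where
    exit : ∀ r k → OnWall A (r , k) → A (mv (k ⁻) r) ≡ false → corner A (r , k ⁻) ≡ true
    exit r k (p , q) nx = corner⁺ {A} {r} {k ⁻} p nx (trans (cong (λ d → A (mv d r)) (⁻⁺ k)) q)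
    lost₁ : ∀ s → proj₁ s ∈ arcCells arc → corner filled s ≡ false
    lost₁ (c , e) c∈ = 𝔹.¬-not λ h →
      false≢true (proj₁ (corner⁻ {filled} {c} {e} h)) (pocket⊆filled c (arc⊆pocket c∈))
    lost₂ : ∀ c e → mv e c ∈ arcCells arc → corner filled (c , e) ≡ false
    lost₂ c e c∈ = 𝔹.¬-not λ h →
      false≢true (proj₁ (proj₂ (corner⁻ {filled} {c} {e} h))) (pocket⊆filled _ (arc⊆pocket c∈))
    go′ : ∀ {r k} (a : Arc x ε r k) → All (OnWall A) (arcStates a) →
      (∀ {v} → v ∈ arcCells a → v ∈ arcCells arc) →
      All (λ s → corner A s ≡ true × corner filled s ≡ false) (exits a)
    go′ leave ((p , _) ∷ _) sub = (exit x ε exit-wall p , lost₂ x (ε ⁻) (sub (here refl))) ∷ []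
    go′ (turn a) (_ ∷ ps) sub = go′ a ps sub
    go′ (go {r} {k} a) ((p , _) ∷ ps) sub =
      (exit r k (All.lookup ps (arc-current∈states a)) p , lost₁ (r , k ⁻) (sub (there (arc-current∈cells a)))) ∷ go′ a ps (sub ∘ there)

  allExits-unique : Unique allExits
  allExits-unique = Uniqueₚ.map⁻ (subst Unique (sym allExits-cells) (prefix (arcCells arc) uniq′))
    where
    prefix : ∀ (xs : List Cell) {y ys} → Unique (xs ++ y ∷ ys) → Unique (xs ++ y ∷ [])
    prefix [] (_ ∷ _) = [] ∷ []
    prefix (z ∷ zs) (p ∷ u) with Allₚ.++⁻ zs p
    ... | l , h ∷ _ = Allₚ.++⁺ l (h ∷ []) ∷ prefix zs u

  allExits-length : length allExits ≡ suc (length (arcCells arc))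
  allExits-length = trans (sym (Listₚ.length-map proj₁ allExits))
    (trans (cong length allExits-cells) (trans (Listₚ.length-++ (arcCells arc)) (ℕₚ.+-comm _ 1)))

  module _ (M : ℕ) (bounded : All (Near M) (cells T)) where

    column-bound : ∀ z → w z ≡ true → ℤ.∣ proj₁ z ∣ ℕ.≤ M
    column-bound z wz = case ℤ.∣ proj₁ z ∣ ℕ.≤? M of λ where
        (yes p) → p
        (no ¬p) → ⊥-elim (false≢true (parity-false (All.tabulate λ {s} s∈ → ray ¬p s (All.lookup bounded (∈Γ⇒cell s∈)))) wz)
      where
      ray : ¬ (ℤ.∣ proj₁ z ∣ ℕ.≤ M) → ∀ s → Near M (proj₁ s) → onRay (edgeOf s) z ≡ false
      ray ¬p (v , d0) _ = refl
      ray ¬p (v , d1) _ = refl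
      ray ¬p (v , d2) (near b _) rewrite dec-false (proj₁ v ℤ.≟ proj₁ z) (λ e → ¬p (subst (λ i → ℤ.∣ i ∣ ℕ.≤ M) e b)) = refl
      ray ¬p (v , d3) _ = refl
      ray ¬p (v , d4) _ = refl
      ray ¬p (v , d5) (near b _) rewrite dec-false (proj₁ v ℤ.≟ proj₁ z) (λ e → ¬p (subst (λ i → ℤ.∣ i ∣ ℕ.≤ M) e b)) = refl

    -- Beyond the visited rows no side of `Γ` separates neighbours in a row, so an enclosed cell
    -- there could be shifted east indefinitely, against `column-bound`.
    row-bound : ∀ z → w z ≡ true → ℤ.∣ proj₂ z ∣ ℕ.≤ M
    row-bound z wz = case ℤ.∣ proj₂ z ∣ ℕ.≤? M of λ where
        (yes p) → p
        (no ¬p) → ⊥-elim (far ¬p)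
      where
      east : ℕ → Cell
      east m = + m ℤ.+ proj₁ z , proj₂ z
      w-east : ¬ (ℤ.∣ proj₂ z ∣ ℕ.≤ M) → ∀ m → w (east m) ≡ true
      w-east ¬p zero = trans (cong (λ i → w (i , proj₂ z)) (ℤₚ.+-identityˡ _)) wz
      w-east ¬p (suc m) = trans (cong (λ i → w (i , proj₂ z)) (ℤₚ.+-assoc (+ 1) (+ m) (proj₁ z)))
        (trans (sym (no-jump (east m) d0 λ s∈ eq → case edge-injective {s = east m} {d0} eq of λ where
          (inj₁ (e , _)) → ¬p (subst (λ i → ℤ.∣ i ∣ ℕ.≤ M) (cong proj₂ e) (∣y∣≤ (All.lookup bounded (∈Γ⇒cell s∈))))
          (inj₂ (e , _)) → ¬p (subst (λ i → ℤ.∣ i ∣ ℕ.≤ M) (cong proj₂ e) (∣y∣≤ (All.lookup bounded (∈Γ⇒cell s∈))))))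
          (w-east ¬p m))
      far : ¬ (ℤ.∣ proj₂ z ∣ ℕ.≤ M) → ⊥
      far ¬p = ℕₚ.<-irrefl refl (ℕₚ.≤-trans
        (ℕₚ.≤-reflexive (cong ℤ.∣_∣ (sym cancel)))
        (ℕₚ.≤-trans (ℤₚ.∣i-j∣≤∣i∣+∣j∣ (proj₁ (east m)) (proj₁ z))
          (ℕₚ.+-mono-≤ (column-bound (east m) (w-east ¬p m)) (column-bound z wz))))
        where
        -- Two columns bounded by `M` in absolute value differ by at most `M + M`, so a shift by one
        -- more is impossible.
        m = suc (M ℕ.+ M)
        cancel : (+ m ℤ.+ proj₁ z) ℤ.- proj₁ z ≡ + m
        cancel = trans (ℤₚ.+-assoc (+ m) (proj₁ z) (ℤ.- proj₁ z))
          (trans (cong (ℤ._+_ (+ m)) (ℤₚ.+-inverseʳ (proj₁ z))) (ℤₚ.+-identityʳ (+ m)))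

    pocket-bounded : ∀ z → pocket z ≡ true → Near M z
    pocket-bounded z p = near (column-bound z (proj₁ (pocket⁻ z p))) (row-bound z (proj₁ (pocket⁻ z p)))

-- Counting left turns

select : {A : Set} → (A → Bool) → List A → List A
select p = filter (λ a → p a 𝔹.≟ true)

module _ {A : Set} (p : A → Bool) where
  ∈-select⁺ : ∀ {a as} → a ∈ as → p a ≡ true → a ∈ select p as
  ∈-select⁺ = ∈-filter⁺ (λ a → p a 𝔹.≟ true)

  ∈-select⁻ : ∀ {a} as → a ∈ select p as → a ∈ as × p a ≡ true
  ∈-select⁻ as = ∈-filter⁻ (λ a → p a 𝔹.≟ true) {xs = as}

  select-unique : ∀ {as} → Unique as → Unique (select p as)
  select-unique = Uniqueₚ.filter⁺ (λ a → p a 𝔹.≟ true)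

bit : Bool → ℕ
bit false = 0
bit true = 1

count : (Dir → Bool) → ℕ
count p = sum (map (bit ∘ p) dirs)

length-select-map : ∀ {A B : Set} (p : B → Bool) (q : A → Bool) (f : A → B) →
  (∀ a → p (f a) ≡ q a) → ∀ as → length (select p (map f as)) ≡ sum (map (bit ∘ q) as)
length-select-map p q f e [] = refl
length-select-map p q f e (a ∷ as) rewrite e a with q a
... | true = cong suc (length-select-map p q f e as)
... | false = length-select-map p q f e as

∀bool? : {P : Bool → Set} → (∀ b → Dec (P b)) → Dec (∀ b → P b)
∀bool? P? = map′ (λ (p , q) → λ { false → p ; true → q }) (λ f → f false , f true) (P? false ×-dec P? true)

bits : Bool → Bool → Bool → Bool → Bool → Bool → Dir → Bool
bits a b c d e f d0 = a
bits a b c d e f d1 = b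
bits a b c d e f d2 = c
bits a b c d e f d3 = d
bits a b c d e f d4 = e
bits a b c d e f d5 = f

-- Here `b` tells which neighbours of a cell to be added lie in the region. The gained left turns
-- have that cell as inner cell; the lost ones had it as either of their two outer cells.
gained lost : (Dir → Bool) → ℕ
gained b = count (λ m → not (b m) ∧ not (b (m ⁺)))
lost b = count (λ m → not (b m) ∧ b (m ⁺)) + count (λ m → not (b m) ∧ b (m ⁻))

bits-η : ∀ (b : Dir → Bool) m → bits (b d0) (b d1) (b d2) (b d3) (b d4) (b d5) m ≡ b m
bits-η b d0 = refl
bits-η b d1 = refl
bits-η b d2 = refl
bits-η b d3 = refl
bits-η b d4 = refl
bits-η b d5 = refl

-- Unless all neighbours are outside, a maximal run of l consecutive outside neighbours gains l - 1
-- turns and loses 2. The net gain is thus at most 5 - 3, and at most 3 - 3 in `gain-surrounded`.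
-- The check runs over all bit patterns.
gain-touching : ∀ (b : Dir → Bool) k → b k ≡ true → gained b ≤ 2 + lost b
gain-touching b k bk = table (b d0) (b d1) (b d2) (b d3) (b d4) (b d5) k (trans (bits-η b k) bk)
  where
  table : ∀ a b c d e f k → bits a b c d e f k ≡ true →
    gained (bits a b c d e f) ≤ 2 + lost (bits a b c d e f)
  table = from-yes (∀bool? λ a → ∀bool? λ b → ∀bool? λ c → ∀bool? λ d → ∀bool? λ e → ∀bool? λ f →
    ∀dir? λ k → (bits a b c d e f k 𝔹.≟ true) →-dec
      (gained (bits a b c d e f) ℕ.≤? 2 + lost (bits a b c d e f)))

gain-surrounded : ∀ (b : Dir → Bool) k → b k ≡ true → b (k ⁻) ≡ true → b (k ⁻ ⁻) ≡ true → gained b ≤ lost b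
gain-surrounded b k p q r = table (b d0) (b d1) (b d2) (b d3) (b d4) (b d5) k
  (trans (bits-η b k) p) (trans (bits-η b (k ⁻)) q) (trans (bits-η b (k ⁻ ⁻)) r)
  where
  table : ∀ a b c d e f k → bits a b c d e f k ≡ true → bits a b c d e f (k ⁻) ≡ true →
    bits a b c d e f (k ⁻ ⁻) ≡ true → gained (bits a b c d e f) ≤ lost (bits a b c d e f)
  table = from-yes (∀bool? λ a → ∀bool? λ b → ∀bool? λ c → ∀bool? λ d → ∀bool? λ e → ∀bool? λ f →
    ∀dir? λ k → (bits a b c d e f k 𝔹.≟ true) →-dec (bits a b c d e f (k ⁻) 𝔹.≟ true) →-dec
      (bits a b c d e f (k ⁻ ⁻) 𝔹.≟ true) →-dec
      (gained (bits a b c d e f) ℕ.≤? lost (bits a b c d e f)))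

range : ℕ → List ℤ
range n = map +_ (upTo (suc n)) ++ map -[1+_] (upTo n)

∈-range⁺ : ∀ {n} i → ℤ.∣ i ∣ ≤ n → i ∈ range n
∈-range⁺ (+ m) p = ∈-++⁺ˡ (∈-map⁺ +_ (∈-upTo⁺ (s≤s p)))
∈-range⁺ {n} (-[1+ m ]) p = ∈-++⁺ʳ (map +_ (upTo (suc n))) (∈-map⁺ -[1+_] (∈-upTo⁺ p))

range-unique : ∀ n → Unique (range n)
range-unique n = Uniqueₚ.++⁺
  (Uniqueₚ.map⁺ (λ { refl → refl }) (Uniqueₚ.upTo⁺ (suc n)))
  (Uniqueₚ.map⁺ (λ { refl → refl }) (Uniqueₚ.upTo⁺ n))
  λ (p , q) → case ∈-map⁻ +_ p , ∈-map⁻ -[1+_] q of λ { ((_ , _ , refl) , (_ , _ , ())) }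

window : ℕ → List Cell
window n = cartesianProduct (range n) (range n)

∈-window : ∀ {n z} → Near n z → z ∈ window n
∈-window (near p q) = ∈-cartesianProduct⁺ (∈-range⁺ _ p) (∈-range⁺ _ q)

window-unique : ∀ n → Unique (window n)
window-unique n = Uniqueₚ.cartesianProduct⁺ (range-unique n) (range-unique n)

near-mv : ∀ {n z} d → Near n z → Near (suc n) (mv d z)
near-mv {n} {i , j} d (near p q) = near (x d i p) (y d j q)
  where
  inc : ∀ i → ℤ.∣ i ∣ ≤ n → ℤ.∣ ℤ.suc i ∣ ≤ suc n
  inc i p = ℕₚ.≤-trans (ℤₚ.∣i+j∣≤∣i∣+∣j∣ (+ 1) i) (s≤s p)
  dec : ∀ i → ℤ.∣ i ∣ ≤ n → ℤ.∣ ℤ.pred i ∣ ≤ suc n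
  dec i p = ℕₚ.≤-trans (ℤₚ.∣i+j∣≤∣i∣+∣j∣ (-[1+ 0 ]) i) (s≤s p)
  x : ∀ d i → ℤ.∣ i ∣ ≤ n → ℤ.∣ dx d i ∣ ≤ suc n
  x d0 = inc
  x d1 = inc
  x d2 i = ℕₚ.m≤n⇒m≤1+n
  x d3 = dec
  x d4 = dec
  x d5 i = ℕₚ.m≤n⇒m≤1+n
  y : ∀ d i → ℤ.∣ i ∣ ≤ n → ℤ.∣ dy d i ∣ ≤ suc n
  y d0 i = ℕₚ.m≤n⇒m≤1+n
  y d1 = inc
  y d2 = inc
  y d3 i = ℕₚ.m≤n⇒m≤1+n
  y d4 = dec
  y d5 = dec

near-suc : ∀ {n z} → Near n z → Near (suc n) z
near-suc (near p q) = near (ℕₚ.m≤n⇒m≤1+n p) (ℕₚ.m≤n⇒m≤1+n q)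

halfPlane : Region
halfPlane (_ , + _) = false
halfPlane (_ , -[1+ _ ]) = true

add : Cell → Region → Region
add x A z = A z ∨ does (z ≟ᶜ x)

add-≢ : ∀ x A z → z ≢ x → add x A z ≡ A z
add-≢ x A z z≢x rewrite dec-false (z ≟ᶜ x) z≢x = 𝔹.∨-identityʳ (A z)

add-self : ∀ x A → add x A x ≡ true
add-self x A rewrite dec-true (x ≟ᶜ x) refl = 𝔹.∨-zeroʳ (A x)

dirs-unique : Unique dirs
dirs-unique = from-yes (UniqueDec.unique? _≟ᵈ_ dirs)

opp-injective : ∀ d e → opp d ≡ opp e → d ≡ e
opp-injective = from-yes (∀dir? λ d → ∀dir? λ e → (opp d ≟ᵈ opp e) →-dec (d ≟ᵈ e))

module Counting (B : ℕ) where

  -- The window exceeds `B` by one because adding a cell also affects left turns recorded at its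
  -- neighbours.
  keys : List State
  keys = cartesianProduct (window (suc B)) dirs

  ∈-keys : ∀ {c e} → Near (suc B) c → (c , e) ∈ keys
  ∈-keys {e = e} p = ∈-cartesianProduct⁺ (∈-window p) (∈-dirs e)

  keys-unique : Unique keys
  keys-unique = Uniqueₚ.cartesianProduct⁺ (window-unique (suc B)) dirs-unique

  corners : Region → List State
  corners A = select (corner A) keys

  corners-unique : ∀ A → Unique (corners A)
  corners-unique A = select-unique (corner A) keys-unique

  Λ : Region → ℕ
  Λ A = length (corners A)

  Λ-+ : ∀ A A′ ks → (∀ s → corner A s ≡ true → corner A′ s ≡ true) → Unique ks →
    All (λ s → s ∈ keys × corner A′ s ≡ true × corner A s ≡ false) ks → length ks + Λ A ≤ Λ A′
  Λ-+ A A′ ks sub u all = subst (_≤ Λ A′) (Listₚ.length-++ ks)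
    (unique-⊆-length (Uniqueₚ.++⁺ u (corners-unique A) λ (p , q) →
        false≢true (proj₂ (proj₂ (All.lookup all p))) (proj₂ (∈-select⁻ (corner A) keys q)))
      λ {s} s∈ → case ∈-++⁻ ks s∈ of λ where
        (inj₁ p) → ∈-select⁺ (corner A′) (proj₁ (All.lookup all p)) (proj₁ (proj₂ (All.lookup all p)))
        (inj₂ q) → let k , c = ∈-select⁻ (corner A) keys q in ∈-select⁺ (corner A′) k (sub s c))

  Λ-mono : ∀ A A′ → (∀ s → corner A s ≡ true → corner A′ s ≡ true) → Λ A ≤ Λ A′
  Λ-mono A A′ sub = Λ-+ A A′ [] sub [] []

  module _ (A : Region) (x : Cell) (nr : Near B x) (x∉A : A x ≡ false) where
    private
      b : Dir → Bool
      b m = A (mv m x)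
      A′ = add x A
      newKeys oldKeys : List State
      newKeys = map (λ m → mv m x , m ⁺ ⁺) dirs
      oldKeys = map (x ,_) dirs ++ map (λ m → mv m x , opp m) dirs

      new : ∀ m → corner A′ (mv m x , m ⁺ ⁺) ≡ not (b m) ∧ not (b (m ⁺))
      new m = cong₂ _∧_ (cong not (add-≢ x A (mv m x) (mv≢ m)))
        (trans (cong₂ _∧_
          (cong not (trans (cong A′ (trans (cong (λ d → mv (m ⁺ ⁺) (mv d x)) (sym (⁺⁻ m))) (mv-tri (m ⁺) x)))
            (add-≢ x A (mv (m ⁺) x) (mv≢ (m ⁺)))))
          (trans (cong A′ (mv-opp m x)) (add-self x A)))
          (𝔹.∧-identityʳ _))

      old₁ : ∀ m → corner A (x , m) ≡ not (b m) ∧ b (m ⁺)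
      old₁ m rewrite x∉A = refl

      ⁺⁴ : ∀ m → m ⁺ ⁺ ⁺ ⁺ ≡ m ⁻ ⁻
      ⁺⁴ = from-yes (∀dir? λ m → m ⁺ ⁺ ⁺ ⁺ ≟ᵈ m ⁻ ⁻)

      old₂ : ∀ m → corner A (mv m x , opp m) ≡ not (b m) ∧ b (m ⁻)
      old₂ m = cong (not (b m) ∧_) (cong₂ _∧_ (cong not (trans (cong A (mv-opp m x)) x∉A))
        (cong A (trans (cong₂ (λ d e → mv d (mv e x)) (⁺⁴ m) (sym (⁻⁺ m))) (mv-tri′ (m ⁻) x))))

      oldKeys-unique : Unique oldKeys
      oldKeys-unique = Uniqueₚ.++⁺
        (Uniqueₚ.map⁺ {f = x ,_} (cong proj₂) dirs-unique)
        (Uniqueₚ.map⁺ {f = λ m → mv m x , opp m} (λ e → opp-injective _ _ (cong proj₂ e)) dirs-unique)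
        λ (p , q) → case ∈-map⁻ (x ,_) p , ∈-map⁻ (λ m → mv m x , opp m) q of
          λ { ((_ , _ , refl) , (m , _ , e)) → mv≢ m (sym (cong proj₁ e)) }

      oldKeys⊆keys : All (_∈ keys) oldKeys
      oldKeys⊆keys = Allₚ.++⁺
        (Allₚ.map⁺ {f = x ,_} (All.universal (λ _ → ∈-keys (near-suc nr)) dirs))
        (Allₚ.map⁺ {f = λ m → mv m x , opp m} (All.universal (λ m → ∈-keys (near-mv m nr)) dirs))

      lostKeys gainedKeys : List State
      lostKeys = select (corner A) oldKeys
      gainedKeys = select (corner A′) newKeys

      old-lost : ∀ s → s ∈ oldKeys → corner A′ s ≡ false
      old-lost (c , e) s∈ = 𝔹.¬-not λ h → [ (λ p → first h (∈-map⁻ (x ,_) p)) , (λ p → second h (∈-map⁻ (λ m → mv m x , opp m) p)) ]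
          (∈-++⁻ (map (x ,_) dirs) s∈)
        where
        first : corner A′ (c , e) ≡ true → (∃ λ m → m ∈ dirs × (c , e) ≡ (x , m)) → ⊥
        first h (_ , _ , refl) = false≢true (proj₁ (corner⁻ {A′} {c} {e} h)) (add-self x A)
        second : corner A′ (c , e) ≡ true → (∃ λ m → m ∈ dirs × (c , e) ≡ (mv m x , opp m)) → ⊥
        second h (m , _ , refl) =
          false≢true (proj₁ (proj₂ (corner⁻ {A′} {c} {e} h))) (trans (cong A′ (mv-opp m x)) (add-self x A))

      new-or-old : ∀ s → corner A′ s ≡ true → corner A s ≡ true ⊎ s ∈ newKeys
      new-or-old (c , e) h with corner⁻ {A′} {c} {e} h
      ... | p , q , t = case mv (e ⁺) c ≟ᶜ x of λ where
          (no ne) → inj₁ (corner⁺ {A} {c} {e} (shrink c p) (shrink (mv e c) q) (trans (sym (add-≢ x A (mv (e ⁺) c) ne)) t))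
          (yes eq) → inj₂ (subst (_∈ newKeys) (cong₂ _,_
            (trans (cong (mv (opp (e ⁺))) (sym eq)) (mv-opp (e ⁺) c)) (⁺⁶ e))
            (∈-map⁺ (λ m → mv m x , m ⁺ ⁺) (∈-dirs (opp (e ⁺)))))
        where
        shrink : ∀ z → A′ z ≡ false → A z ≡ false
        shrink z r with A z
        ... | false = refl
        ⁺⁶ : ∀ m → m ⁺ ⁺ ⁺ ⁺ ⁺ ⁺ ≡ m
        ⁺⁶ = from-yes (∀dir? λ m → m ⁺ ⁺ ⁺ ⁺ ⁺ ⁺ ≟ᵈ m)

    -- No lost turn survives in the new region, and every turn of the new region is old or has `x`
    -- as inner cell; comparing both lists avoids subtraction.
    add-cost : lost b + Λ A′ ≤ gained b + Λ A
    add-cost = subst₂ _≤_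
      (trans (Listₚ.length-++ lostKeys) (cong (_+ Λ A′) lost-length))
      (trans (Listₚ.length-++ gainedKeys)
        (cong (_+ Λ A) (length-select-map (corner A′) _ (λ m → mv m x , m ⁺ ⁺) new dirs)))
      (unique-⊆-length
        (Uniqueₚ.++⁺ (select-unique (corner A) oldKeys-unique) (corners-unique A′) λ (p , q) →
          false≢true (old-lost _ (proj₁ (∈-select⁻ (corner A) oldKeys p))) (proj₂ (∈-select⁻ (corner A′) keys q)))
        λ s∈ → case ∈-++⁻ lostKeys s∈ of λ where
          (inj₁ p) → let k , c = ∈-select⁻ (corner A) oldKeys p in
            ∈-++⁺ʳ gainedKeys (∈-select⁺ (corner A) (All.lookup oldKeys⊆keys k) c)
          (inj₂ p) → let k , c = ∈-select⁻ (corner A′) keys p in case new-or-old _ c of λ where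
            (inj₁ q) → ∈-++⁺ʳ gainedKeys (∈-select⁺ (corner A) k q)
            (inj₂ q) → ∈-++⁺ˡ (∈-select⁺ (corner A′) q c))
      where
      lost-length : length lostKeys ≡ lost b
      lost-length = trans (cong length (Listₚ.filter-++ (λ s → corner A s 𝔹.≟ true) (map (x ,_) dirs) _))
        (trans (Listₚ.length-++ (select (corner A) (map (x ,_) dirs)))
          (cong₂ _+_ (length-select-map (corner A) _ (x ,_) old₁ dirs)
                     (length-select-map (corner A) _ (λ m → mv m x , opp m) old₂ dirs)))

    add-touching : ∀ k → A (mv k x) ≡ true → Λ A′ ≤ 2 + Λ A
    add-touching k p = ℕₚ.+-cancelˡ-≤ (lost b) _ _ (ℕₚ.≤-trans add-cost
      (ℕₚ.≤-trans (ℕₚ.+-monoˡ-≤ (Λ A) (gain-touching b k p))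
        (ℕₚ.≤-reflexive (trans (cong (_+ Λ A) (ℕₚ.+-comm 2 (lost b))) (ℕₚ.+-assoc (lost b) 2 (Λ A))))))

    add-surrounded : ∀ k → A (mv k x) ≡ true → A (mv (k ⁻) x) ≡ true → A (mv (k ⁻ ⁻) x) ≡ true →
      Λ A′ ≤ Λ A
    add-surrounded k p q r = ℕₚ.+-cancelˡ-≤ (lost b) _ _ (ℕₚ.≤-trans add-cost
      (ℕₚ.+-monoˡ-≤ (Λ A) (gain-surrounded b k p q r)))

  -- The left turns of the half plane are recorded in row 0 with direction `d3`, one per column.
  halfPlane-Λ : Λ halfPlane ≤ length (range (suc B))
  halfPlane-Λ = subst (Λ halfPlane ≤_) (Listₚ.length-map (λ i → (i , + 0) , d3) (range (suc B)))
    (unique-⊆-length (corners-unique halfPlane) λ {s} s∈ →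
      let s∈keys , c = ∈-select⁻ (corner halfPlane) keys s∈
          z∈ , _ = ∈-cartesianProduct⁻ (window (suc B)) dirs s∈keys
          i∈ , _ = ∈-cartesianProduct⁻ (range (suc B)) (range (suc B)) z∈
      in flat s i∈ c)
    where
    flat : ∀ s → proj₁ (proj₁ s) ∈ range (suc B) → corner halfPlane s ≡ true →
      s ∈ map (λ i → (i , + 0) , d3) (range (suc B))
    flat ((i , + zero) , d3) i∈ _ = ∈-map⁺ (λ i → (i , + 0) , d3) i∈
    flat ((i , + zero) , d0) _ ()
    flat ((i , + zero) , d1) _ ()
    flat ((i , + zero) , d2) _ ()
    flat ((i , + zero) , d4) _ ()
    flat ((i , + zero) , d5) _ ()
    flat ((i , + suc n) , d0) _ ()
    flat ((i , + suc n) , d1) _ ()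
    flat ((i , + suc n) , d2) _ ()
    flat ((i , + suc n) , d3) _ ()
    flat ((i , + suc n) , d4) _ ()
    flat ((i , + suc n) , d5) _ ()
    flat ((i , -[1+ n ]) , e) _ ()

  module _ (C : Region) (half⊆ : ∀ z → halfPlane z ≡ true → C z ≡ true)
    (supp : ∀ z → C z ≡ true → halfPlane z ≡ true ⊎ Near B z) where

    bare : ∀ i n → suc B ≤ n → C (i , + n) ≡ false
    bare i n p = 𝔹.¬-not λ h → case supp (i , + n) h of λ where
      (inj₂ (near _ q)) → ℕₚ.<-irrefl refl (ℕₚ.≤-trans p q)

    Top : ℤ → ℕ → Set
    Top i t = ∃ λ e → (e ≡ d3 ⊎ e ≡ d4) × corner C ((i , + t) , e) ≡ true

    -- Row t of the column pair (i - 1, i) is at height t - 1, so that row 0 lies in the half plane.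
    climb : ∀ i fuel t → suc B ≤ fuel + t →
      C (ℤ.pred i , ℤ.pred (+ t)) ≡ true ⊎ C (i , ℤ.pred (+ t)) ≡ true → t ≤ suc B →
      ∃ λ t′ → t′ ≤ suc B × Top i t′
    climb i fuel t le occ t≤ = step (C (ℤ.pred i , + t) 𝔹.≟ true) (C (i , + t) 𝔹.≟ true) fuel le
      where
      next : ∀ fuel → suc B ≤ fuel + t → C (ℤ.pred i , + t) ≡ true ⊎ C (i , + t) ≡ true →
        ∃ λ t′ → t′ ≤ suc B × Top i t′
      next zero le (inj₁ p) = ⊥-elim (false≢true (bare _ t le) p)
      next zero le (inj₂ p) = ⊥-elim (false≢true (bare _ t le) p)
      next (suc fuel) le occ = climb i fuel (suc t) (subst (suc B ≤_) (sym (ℕₚ.+-suc fuel t)) le) occ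
        (ℕₚ.≰⇒> λ q → [ false≢true (bare _ t q) , false≢true (bare _ t q) ] occ)
      step : Dec (C (ℤ.pred i , + t) ≡ true) → Dec (C (i , + t) ≡ true) →
        ∀ fuel → suc B ≤ fuel + t → ∃ λ t′ → t′ ≤ suc B × Top i t′
      step (yes p) _ fuel le = next fuel le (inj₁ p)
      step (no _) (yes p) fuel le = next fuel le (inj₂ p)
      -- An empty row of the column pair above an occupied one: the turn has direction `d3` if the
      -- left cell below is occupied, and `d4` if only the right one is.
      step (no ¬p) (no ¬q) _ _ = t , t≤ , (case C (ℤ.pred i , ℤ.pred (+ t)) 𝔹.≟ true of λ where
        (yes l) → d3 , inj₁ refl , corner⁺ {C} {i , + t} {d3} (𝔹.¬-not ¬q) (𝔹.¬-not ¬p) l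
        (no ¬l) → d4 , inj₂ refl , corner⁺ {C} {i , + t} {d4} (𝔹.¬-not ¬q) (𝔹.¬-not ¬l)
          ([ (λ l → ⊥-elim (¬l l)) , id ] occ))

    topCorner : ∀ i → ∃ λ t → t ≤ suc B × Top i t
    topCorner i = climb i (suc B) 0 (ℕₚ.≤-reflexive (sym (ℕₚ.+-identityʳ (suc B)))) (inj₁ (half⊆ _ refl)) z≤n

    topKey : ℤ → State
    topKey i = let t , _ , e , _ = topCorner i in (i , + t) , e

    -- Walking to the right from a cell outside the half plane leads to a corner of direction d2,
    -- whereas top corners have direction d3 or d4.
    slope : ∀ fuel z → + suc B ℤ.≤ proj₁ z ℤ.+ + fuel → C z ≡ true → halfPlane z ≡ false →
      ∃ λ s → s ∈ keys × proj₂ s ≡ d2 × corner C s ≡ true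
    slope fuel z le z∈ out = step (C (mv d0 z) 𝔹.≟ true) (C (mv d1 z) 𝔹.≟ true) fuel le
      where
      nz : Near B z
      nz = [ (λ h → ⊥-elim (false≢true out h)) , id ] (supp z z∈)
      next : ∀ fuel → + suc B ℤ.≤ proj₁ z ℤ.+ + fuel → ∀ j → C (ℤ.suc (proj₁ z) , j) ≡ true →
        halfPlane (ℤ.suc (proj₁ z) , j) ≡ false → ∃ λ s → s ∈ keys × proj₂ s ≡ d2 × corner C s ≡ true
      next zero le _ _ _ = ⊥-elim (absurd (proj₁ z) (∣x∣≤ nz) (subst (+ suc B ℤ.≤_) (ℤₚ.+-identityʳ _) le))
        where
        absurd : ∀ i → ℤ.∣ i ∣ ≤ B → ¬ + suc B ℤ.≤ i
        absurd (+ i) p (ℤ.+≤+ q) = ℕₚ.<-irrefl refl (ℕₚ.≤-trans q p)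
      next (suc fuel) le j p o = slope fuel (ℤ.suc (proj₁ z) , j) (subst (+ suc B ℤ.≤_) eq le) p o
        where
        eq : proj₁ z ℤ.+ + suc fuel ≡ ℤ.suc (proj₁ z) ℤ.+ + fuel
        eq = trans (sym (ℤₚ.+-assoc (proj₁ z) (+ 1) (+ fuel))) (cong (ℤ._+ + fuel) (ℤₚ.+-comm (proj₁ z) (+ 1)))
      step : Dec (C (mv d0 z) ≡ true) → Dec (C (mv d1 z) ≡ true) →
        ∀ fuel → + suc B ℤ.≤ proj₁ z ℤ.+ + fuel → ∃ λ s → s ∈ keys × proj₂ s ≡ d2 × corner C s ≡ true
      step (yes p) _ fuel le = next fuel le (proj₂ z) p (same (proj₂ z) out)
        where
        same : ∀ j → halfPlane (proj₁ z , j) ≡ false → halfPlane (ℤ.suc (proj₁ z) , j) ≡ false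
        same (+ _) _ = refl
      step (no _) (yes p) fuel le = next fuel le (ℤ.suc (proj₂ z)) p (same (proj₂ z) out)
        where
        same : ∀ j → halfPlane (proj₁ z , j) ≡ false → halfPlane (ℤ.suc (proj₁ z) , ℤ.suc j) ≡ false
        same (+ _) _ = refl
      step (no ¬p) (no ¬q) _ _ = (mv d0 z , d2) , ∈-keys (near-mv d0 nz) , refl ,
        corner⁺ {C} {mv d0 z} {d2} (𝔹.¬-not ¬p) (𝔹.¬-not ¬q) (trans (cong C (mv-opp d0 z)) z∈)

    -- `C` has a top turn in each column, already as many as `halfPlane-Λ` allows the half plane,
    -- and the turn found by `slope` is one more because its direction is different.
    halfPlane-minimal : ∀ z → C z ≡ true → halfPlane z ≡ false → Λ halfPlane < Λ C
    halfPlane-minimal z z∈ out = ℕₚ.≤-trans (s≤s halfPlane-Λ)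
      (subst (λ n → suc n ≤ Λ C) (Listₚ.length-map topKey (range (suc B)))
        (unique-⊆-length {xs = s ∷ map topKey (range (suc B))}
          (All.tabulate fresh ∷ Uniqueₚ.map⁺ {f = topKey} (cong (proj₁ ∘ proj₁)) (range-unique (suc B)))
          member))
      where
      -- Enough steps to the right to leave the window from its leftmost column `- B`.
      fuel = suc B + B
      enough : ∀ i → ℤ.∣ i ∣ ≤ B → + suc B ℤ.≤ i ℤ.+ + fuel
      enough (+ i) p = ℤ.+≤+ (ℕₚ.≤-trans (ℕₚ.m≤m+n (suc B) B) (ℕₚ.m≤n+m fuel i))
      enough -[1+ i ] p = subst (+ suc B ℤ.≤_) (sym (ℤₚ.⊖-≥ (ℕₚ.≤-trans p (ℕₚ.m≤n+m B (suc B)))))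
        (ℤ.+≤+ (subst (suc B ≤_) (sym (ℕₚ.+-∸-assoc (suc B) p)) (ℕₚ.m≤m+n (suc B) _)))
      ex = slope fuel z (enough (proj₁ z) ([ (λ h → ⊥-elim (false≢true out h)) , ∣x∣≤ ] (supp z z∈))) z∈ out
      s = proj₁ ex
      fresh : ∀ {s′} → s′ ∈ map topKey (range (suc B)) → s ≢ s′
      fresh s′∈ e = case ∈-map⁻ topKey s′∈ of λ { (i , _ , refl) →
        let _ , _ , _ , e34 , _ = topCorner i
            d2≡ = trans (sym (proj₁ (proj₂ (proj₂ ex)))) (cong proj₂ e)
        in case e34 of λ where
          (inj₁ q) → case trans d2≡ q of λ ()
          (inj₂ q) → case trans d2≡ q of λ () }
      member : ∀ {s′} → s′ ∈ s ∷ map topKey (range (suc B)) → s′ ∈ corners C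
      member (here refl) = ∈-select⁺ (corner C) (proj₁ (proj₂ ex)) (proj₂ (proj₂ (proj₂ ex)))
      member (there s′∈) = case ∈-map⁻ topKey s′∈ of λ { (i , i∈ , refl) →
        let t , t≤ , e , _ , c = topCorner i in
        ∈-select⁺ (corner C) (∈-cartesianProduct⁺ (∈-cartesianProduct⁺ i∈ (∈-range⁺ (+ t) t≤)) (∈-dirs e)) c }

-- Optimal regions

_⊑_ : Region → Region → Set
A ⊑ C = ∀ z → A z ≡ true → C z ≡ true

_∪_ : Region → Region → Region
(A ∪ C) z = A z ∨ C z

∪⁻ : ∀ (A C : Region) z → (A ∪ C) z ≡ true → A z ≡ true ⊎ C z ≡ true
∪⁻ A C z p with A z
... | true = inj₁ refl
... | false = inj₂ p

∪⁺ˡ : ∀ (A C : Region) → A ⊑ (A ∪ C)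
∪⁺ˡ A C z p rewrite p = refl

∪⁺ʳ : ∀ (A C : Region) → C ⊑ (A ∪ C)
∪⁺ʳ A C z p rewrite p = 𝔹.∨-zeroʳ (A z)

add⁻ : ∀ x A z → add x A z ≡ true → A z ≡ true ⊎ z ≡ x
add⁻ x A z p with A z | z ≟ᶜ x
... | true | _ = inj₁ refl
... | false | yes z≡x = inj₂ z≡x

⊑-add : ∀ x A → A ⊑ add x A
⊑-add x A z p rewrite p = refl

burnt : List Cell → Region → ℕ
burnt [] A = 0
burnt (b ∷ bs) A = bit (A b) + burnt bs A

bit-mono : ∀ {a b} → (a ≡ true → b ≡ true) → bit a ≤ bit b
bit-mono {false} f = z≤n
bit-mono {true} f rewrite f refl = ℕₚ.≤-refl

bit≤1 : ∀ a → bit a ≤ 1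
bit≤1 false = z≤n
bit≤1 true = ℕₚ.≤-refl

burnt-mono : ∀ bs {A C} → A ⊑ C → burnt bs A ≤ burnt bs C
burnt-mono [] sub = z≤n
burnt-mono (b ∷ bs) sub = ℕₚ.+-mono-≤ (bit-mono (sub b)) (burnt-mono bs sub)

burnt-add : ∀ {x A} bs → x ∈ bs → A x ≡ false → suc (burnt bs A) ≤ burnt bs (add x A)
burnt-add {x} {A} (_ ∷ bs) (here refl) x∉A rewrite add-self x A | x∉A =
  s≤s (burnt-mono bs (⊑-add x A))
burnt-add {x} {A} (b ∷ bs) (there x∈) x∉A = subst (_≤ burnt (b ∷ bs) (add x A)) (ℕₚ.+-suc (bit (A b)) (burnt bs A))
  (ℕₚ.+-mono-≤ (bit-mono (⊑-add x A b)) (burnt-add bs x∈ x∉A))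

regions : List Cell → List Region
regions [] = (λ _ → false) ∷ []
regions (c ∷ cs) = regions cs ++ map (add c) (regions cs)

regions-support : ∀ cs {f z} → f ∈ regions cs → f z ≡ true → z ∈ cs
regions-support [] (here refl) ()
regions-support (c ∷ cs) {z = z} f∈ p with ∈-++⁻ (regions cs) f∈
... | inj₁ q = there (regions-support cs q p)
... | inj₂ q with ∈-map⁻ (add c) q
...   | g , g∈ , refl = case add⁻ c g z p of λ where
  (inj₁ r) → there (regions-support cs g∈ r)
  (inj₂ r) → here r

-- This makes the search for a better region finite: any competitor agrees on the window with a
-- listed one.
regions-complete : ∀ g cs → ∃ λ f → f ∈ regions cs × f ⊑ g × (∀ {z} → z ∈ cs → g z ≡ true → f z ≡ true)
regions-complete g [] = _ , here refl , (λ _ ()) , λ ()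
regions-complete g (c ∷ cs) with regions-complete g cs | g c 𝔹.≟ true
... | f , f∈ , f⊑g , g⊑f | yes p =
  add c f , ∈-++⁺ʳ (regions cs) (∈-map⁺ (add c) f∈) ,
  (λ z q → [ f⊑g z , (λ { refl → p }) ] (add⁻ c f z q)) ,
  λ { (here refl) _ → add-self c f ; {z} (there z∈) q → ⊑-add c f z (g⊑f z∈ q) }
... | f , f∈ , f⊑g , g⊑f | no ¬p =
  f , ∈-++⁺ˡ f∈ , f⊑g , λ { (here refl) q → ⊥-elim (¬p q) ; (there z∈) q → g⊑f z∈ q }

∈-range⁻ : ∀ {n} i → i ∈ range n → ℤ.∣ i ∣ ≤ n
∈-range⁻ {n} i i∈ with ∈-++⁻ (map +_ (upTo (suc n))) i∈
... | inj₁ p with ∈-map⁻ +_ p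
...   | _ , q , refl = ℕₚ.≤-pred (∈-upTo⁻ q)
∈-range⁻ {n} i i∈ | inj₂ p with ∈-map⁻ -[1+_] p
...   | _ , q , refl = ∈-upTo⁻ q

∈-window⁻ : ∀ {n z} → z ∈ window n → Near n z
∈-window⁻ {n} z∈ = let p , q = ∈-cartesianProduct⁻ (range n) (range n) z∈ in near (∈-range⁻ _ p) (∈-range⁻ _ q)

near-≤ : ∀ {m n z} → m ≤ n → Near m z → Near n z
near-≤ m≤n (near p q) = near (ℕₚ.≤-trans p m≤n) (ℕₚ.≤-trans q m≤n)

module Strategy (B : ℕ) where
  open Counting B

  Supported : Region → Set
  Supported A = ∀ z → A z ≡ true → halfPlane z ≡ true ⊎ Near B z

  -- Every proper extension C of A avoiding vs has value less than δ plus the value of A, with the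
  -- terms moved so that no subtraction occurs.
  Stab : Region → List Cell → List Cell → ℕ → Set
  Stab A bs vs δ = ∀ C → A ⊑ C → Supported C → All (λ v → C v ≡ false) vs →
    ∀ z → C z ≡ true → A z ≡ false → 2 * burnt bs C + Λ A < δ + (2 * burnt bs A + Λ C)

  -- The region chosen s turns ago only had to avoid the cells visited by then, which are two fewer per
  -- turn; the burns since then, one per turn, have weakened its maximality by 2s.
  Stabs : Region → List Cell → List Cell → ℕ → Set
  Stabs A bs [] δ = ⊥
  Stabs A bs (v ∷ []) δ = Stab A bs (v ∷ []) δ
  Stabs A bs (v ∷ u ∷ vs) δ = Stab A bs (v ∷ u ∷ vs) δ × Stabs A bs vs (2 + δ)

  stabs-head : ∀ {A bs} vs {δ} → Stabs A bs vs δ → Stab A bs vs δ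
  stabs-head (v ∷ []) st = st
  stabs-head (v ∷ u ∷ vs) (st , _) = st

  stabs-map : ∀ {A bs A′ bs′} → (∀ vs δ → Stab A bs vs δ → Stab A′ bs′ vs (2 + δ)) →
    ∀ vs {δ} → Stabs A bs vs δ → Stabs A′ bs′ vs (2 + δ)
  stabs-map f (v ∷ []) {δ} st = f (v ∷ []) δ st
  stabs-map f (v ∷ u ∷ vs) {δ} (st , sts) = f (v ∷ u ∷ vs) δ st , stabs-map f vs sts

  -- Each turn contributes two cells and weakens the bound by 2. If `x` was the middle cell of a
  -- turn, the entry beginning one cell earlier is used, which accounts for the extra 1.
  stabs-lookup : ∀ {A bs} vs {δ} → Stabs A bs vs δ → ∀ as {x os} → vs ≡ as ++ x ∷ os →
    ∃₂ λ ws δ′ → Stab A bs ws δ′ × (∀ v → v ∈ ws → v ∈ x ∷ os) × δ′ ≤ suc (length as) + δ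
  stabs-lookup (v ∷ []) st [] refl = _ , _ , st , (λ _ → id) , ℕₚ.n≤1+n _
  stabs-lookup (v ∷ []) st (_ ∷ []) ()
  stabs-lookup (v ∷ []) st (_ ∷ _ ∷ _) ()
  stabs-lookup (v ∷ u ∷ vs) (st , _) [] refl = _ , _ , st , (λ _ → id) , ℕₚ.n≤1+n _
  stabs-lookup (v ∷ u ∷ vs) (_ , sts) (_ ∷ []) refl = vs , _ , stabs-head vs sts , (λ _ → there) , ℕₚ.≤-refl
  stabs-lookup (v ∷ u ∷ vs) {δ} (_ , sts) (_ ∷ _ ∷ as) refl =
    let ws , δ′ , st , sub , le = stabs-lookup vs sts as refl
    in ws , δ′ , st , sub , ℕₚ.≤-trans le (ℕₚ.≤-reflexive (eq (length as) δ))
    where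
    eq : ∀ a d → suc a + (2 + d) ≡ suc (suc (suc a)) + d
    eq = solve-∀

  -- The new burn raises the value of `C` by at most 2, while by the second hypothesis `A′` is worth
  -- at least as much as `A` was.
  stab-burn : ∀ {A bs A′ b} → A ⊑ A′ → 2 * burnt bs A + Λ A′ ≤ 2 * burnt (b ∷ bs) A′ + Λ A →
    ∀ vs δ → Stab A bs vs δ → Stab A′ (b ∷ bs) vs (2 + δ)
  stab-burn {A} {bs} {A′} {b} sub gain vs δ st C A′⊑C supp avoid z z∈ z∉ =
    ℕₚ.+-cancelˡ-< (2 * burnt bs A + Λ A) _ _ (begin-strict
      (2 * burnt bs A + Λ A) + (2 * (bit (C b) + burnt bs C) + Λ A′)
        ≡⟨ eq₁ (burnt bs A) (Λ A) (bit (C b)) (burnt bs C) (Λ A′) ⟩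
      2 * bit (C b) + ((2 * burnt bs C + Λ A) + (2 * burnt bs A + Λ A′))
        <⟨ ℕₚ.+-mono-≤-< (ℕₚ.*-monoʳ-≤ 2 (bit≤1 (C b)))
             (ℕₚ.+-mono-<-≤ (st C (λ y p → A′⊑C y (sub y p)) supp avoid z z∈ (z∉A (A z) refl)) gain) ⟩
      2 + ((δ + (2 * burnt bs A + Λ C)) + (2 * burnt (b ∷ bs) A′ + Λ A))
        ≡⟨ eq₂ δ (burnt bs A) (Λ C) (burnt (b ∷ bs) A′) (Λ A) ⟩
      (2 * burnt bs A + Λ A) + ((2 + δ) + (2 * burnt (b ∷ bs) A′ + Λ C)) ∎)
    where
    open ℕₚ.≤-Reasoning
    z∉A : ∀ a → A z ≡ a → A z ≡ false
    z∉A false e = e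
    z∉A true e = ⊥-elim (false≢true z∉ (sub z e))
    eq₁ : ∀ a l t c l′ → (2 * a + l) + (2 * (t + c) + l′) ≡ 2 * t + ((2 * c + l) + (2 * a + l′))
    eq₁ = solve-∀
    eq₂ : ∀ d a l a′ m → 2 + ((d + (2 * a + l)) + (2 * a′ + m)) ≡ (2 * a + m) + ((2 + d) + (2 * a′ + l))
    eq₂ = solve-∀

  -- With slack 0, `stable` makes every admissible proper extension strictly worse, so ties have
  -- gone to the larger region.
  record Optimum (A : Region) (bs vs : List Cell) : Set where
    field
      region    : Region
      extends   : A ⊑ region
      supported : Supported region
      avoids    : All (λ v → region v ≡ false) vs
      gain      : 2 * burnt bs A + Λ region ≤ 2 * burnt bs region + Λ A
      stable    : Stab region bs vs 0

  -- As long as a proper extension of no smaller value exists, pass to it; each time fewer cells of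
  -- the window remain free.
  optimise : ∀ A bs vs → halfPlane ⊑ A → Supported A → All (λ v → A v ≡ false) vs → Optimum A bs vs
  optimise A bs vs half⊑ supp av = improve (length (free A)) A ℕₚ.≤-refl half⊑ supp av
    where
    free : Region → List Cell
    free A = select (not ∘ A) (window B)

    Better : Region → Region → Set
    Better A f = All (λ v → (A ∪ f) v ≡ false) vs × Any (λ z → f z ≡ true × A z ≡ false) (window B)
      × 2 * burnt bs A + Λ (A ∪ f) ≤ 2 * burnt bs (A ∪ f) + Λ A

    better? : ∀ A f → Dec (Better A f)
    better? A f = All.all? (λ v → (A ∪ f) v 𝔹.≟ false) vs
      ×-dec Any.any? (λ z → (f z 𝔹.≟ true) ×-dec (A z 𝔹.≟ false)) (window B)
      ×-dec (_ ℕ.≤? _)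

    stable : ∀ A → halfPlane ⊑ A → ¬ Any (Better A) (regions (window B)) → Stab A bs vs 0
    stable A half⊑ none C A⊑C suppC avoid z z∈ z∉ = ℕₚ.≰⇒> λ le →
      none (lose f∈ (avoid′ , lose (inWindow z z∈ z∉) (g⊑f (inWindow z z∈ z∉) z∈ , z∉) ,
        ℕₚ.≤-trans (ℕₚ.+-monoʳ-≤ (2 * burnt bs A) (Λ-mono (A ∪ f) C corner≤))
          (ℕₚ.≤-trans le (ℕₚ.+-monoˡ-≤ (Λ A) (ℕₚ.*-monoʳ-≤ 2 (burnt-mono bs C⊑))))))
      where
      ex = regions-complete C (window B)
      f = proj₁ ex
      f∈ = proj₁ (proj₂ ex)
      f⊑C = proj₁ (proj₂ (proj₂ ex))
      g⊑f = proj₂ (proj₂ (proj₂ ex))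
      inWindow : ∀ z → C z ≡ true → A z ≡ false → z ∈ window B
      inWindow z z∈ z∉ = [ (λ h → ⊥-elim (false≢true z∉ (half⊑ z h))) , ∈-window ] (suppC z z∈)
      ⊑C : (A ∪ f) ⊑ C
      ⊑C z p = [ A⊑C z , f⊑C z ] (∪⁻ A f z p)
      C⊑ : C ⊑ (A ∪ f)
      C⊑ z p = case A z 𝔹.≟ true of λ where
        (yes q) → ∪⁺ˡ A f z q
        (no ¬q) → ∪⁺ʳ A f z (g⊑f (inWindow z p (𝔹.¬-not ¬q)) p)
      C≗ : ∀ z → (A ∪ f) z ≡ C z
      C≗ z = ⇔→≡ (⊑C z) (C⊑ z)
        where
        ⇔→≡ : ∀ {a b} → (a ≡ true → b ≡ true) → (b ≡ true → a ≡ true) → a ≡ b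
        ⇔→≡ {false} {false} f g = refl
        ⇔→≡ {false} {true} f g = g refl
        ⇔→≡ {true} {b} f g = sym (f refl)
      avoid′ : All (λ v → (A ∪ f) v ≡ false) vs
      avoid′ = All.map (λ {v} p → trans (C≗ v) p) avoid
      corner≤ : ∀ s → corner (A ∪ f) s ≡ true → corner C s ≡ true
      corner≤ (c , e) h = let p , q , t = corner⁻ {A ∪ f} {c} {e} h in
        corner⁺ {C} {c} {e} (trans (sym (C≗ _)) p) (trans (sym (C≗ _)) q) (trans (sym (C≗ _)) t)

    improve : ∀ fuel A → length (free A) ≤ fuel → halfPlane ⊑ A → Supported A →
      All (λ v → A v ≡ false) vs → Optimum A bs vs
    improve fuel A le half⊑ supp av with Any.any? (better? A) (regions (window B))
    ... | no none = record
      { region = A ; extends = λ _ p → p ; supported = supp ; avoids = av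
      ; gain = ℕₚ.≤-refl ; stable = stable A half⊑ none }
    ... | yes some with find some
    ...   | f , f∈ , av′ , new , gain = extend fuel le
      where
      A′ = A ∪ f
      supp′ : Supported A′
      supp′ z p = [ supp z , inj₂ ∘ ∈-window⁻ ∘ regions-support (window B) f∈ ] (∪⁻ A f z p)
      smaller : suc (length (free A′)) ≤ length (free A)
      smaller with find new
      ... | z , z∈ , fz , Az = unique-⊆-length {xs = z ∷ free A′}
        (All.tabulate (λ y∈ → λ { refl → false≢true
            (trans (cong not (∪⁺ʳ A f z fz)) refl) (proj₂ (∈-select⁻ (not ∘ A′) (window B) y∈)) })
          ∷ select-unique (not ∘ A′) (window-unique B))
        λ { (here refl) → ∈-select⁺ (not ∘ A) z∈ (cong not Az)
          ; {y} (there y∈) → let w , q = ∈-select⁻ (not ∘ A′) (window B) y∈ in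
              ∈-select⁺ (not ∘ A) w (not-mono (A y) (f y) q) }
        where
        not-mono : ∀ a b → not (a ∨ b) ≡ true → not a ≡ true
        not-mono false b _ = refl
      extend : ∀ fuel → length (free A) ≤ fuel → Optimum A bs vs
      extend zero le = case ℕₚ.≤-trans smaller le of λ ()
      extend (suc fuel) le = record
        { region = region ; extends = λ z p → extends z (∪⁺ˡ A f z p) ; supported = supported
        ; avoids = avoids ; stable = stable′
        ; gain = ℕₚ.+-cancelˡ-≤ (2 * burnt bs A′ + Λ A′) _ _
            (subst₂ _≤_ (eq₁ (burnt bs A) (Λ region) (burnt bs A′) (Λ A′))
              (eq₂ (burnt bs A′) (Λ A) (burnt bs region) (Λ A′)) (ℕₚ.+-mono-≤ gain gain′)) }
        where
        open Optimum (improve fuel A′ (ℕₚ.≤-pred (ℕₚ.≤-trans smaller le))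
          (λ z p → ∪⁺ˡ A f z (half⊑ z p)) supp′ av′) renaming (gain to gain′; stable to stable′)
        eq₁ : ∀ a l a′ l′ → (2 * a + l′) + (2 * a′ + l) ≡ (2 * a′ + l′) + (2 * a + l)
        eq₁ = solve-∀
        eq₂ : ∀ a′ l r l′ → (2 * a′ + l) + (2 * r + l′) ≡ (2 * a′ + l′) + (2 * r + l)
        eq₂ = solve-∀

-- The runner's turn

infix 4 _⇝_
_⇝_ : Cell → Cell → Set
z ⇝ z′ = ∃ λ e → z′ ≡ mv e (mv e z) ⊎ z′ ≡ mv (e ⁺) (mv e z)

below-halfPlane : ∀ z → proj₂ z ℤ.< + 0 → halfPlane z ≡ true
below-halfPlane (_ , -[1+ _ ]) _ = refl
below-halfPlane (_ , + _) (ℤ.+<+ ())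

⊝-shift : ∀ κ n → (κ ⁻) ⊝ n ≡ (κ ⊝ n) ⁻
⊝-shift κ zero = refl
⊝-shift κ (suc n) = cong _⁻ (⊝-shift κ n)

module Turn (B : ℕ) where
  open Counting B
  open Strategy B

  module _ {A : Region} (half⊑ : halfPlane ⊑ A) (supp : Supported A) {bs vs}
    (stabs : Stabs A bs vs 0) where

    -- A return would close a loop. Filling its pocket loses as many left turns as the loop has
    -- moves, which is at least the slack accumulated since `x` was visited, contradicting
    -- stability. The two shapes are the trail before the first and before the second move of a
    -- turn.
    fresh : ∀ {r k} (T : Trail r k) → All (OnWall A) (states T) → Unique (cells T) →
      proj₂ (origin T) ℤ.< + 0 → All (Near B) (cells T) →
      cells T ≡ vs ⊎ (∃ λ m → cells T ≡ m ∷ vs) → mv (k ⁻) r ∉ cells T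
    fresh T wall uniq orig near-B shape x∈ =
      ℕₚ.<-irrefl refl (begin-strict
        2 * burnt bs A + (length allExits + Λ filled)
          ≤⟨ ℕₚ.+-mono-≤ (ℕₚ.*-monoʳ-≤ 2 (burnt-mono bs A⊆filled)) exits-lost ⟩
        2 * burnt bs filled + Λ A
          <⟨ proj₁ (proj₂ (proj₂ found)) filled A⊆filled supp′
               (All.tabulate λ {v} v∈ → older∉filled (proj₁ (proj₂ (proj₂ (proj₂ found))) v v∈))
               y (pocket⊆filled y (arc⊆pocket y∈)) (proj₁ (proj₂ (pocket⁻ y (arc⊆pocket y∈)))) ⟩
        δ + (2 * burnt bs A + Λ filled)
          ≤⟨ ℕₚ.+-monoˡ-≤ _ (ℕₚ.≤-trans (proj₂ (proj₂ (proj₂ (proj₂ found)))) (ℕₚ.≤-reflexive (sym allExits-length))) ⟩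
        length allExits + (2 * burnt bs A + Λ filled)
          ≡⟨ swap (length allExits) (2 * burnt bs A) (Λ filled) ⟩
        2 * burnt bs A + (length allExits + Λ filled) ∎)
      where
      open ℕₚ.≤-Reasoning
      open Loop A T wall uniq (λ z p → half⊑ z (below-halfPlane z p)) orig x∈
      swap : ∀ a b c → a + (b + c) ≡ b + (a + c)
      swap = solve-∀
      arcCell : ∀ {ε r k} (a : Arc x ε r k) → ∃ (_∈ arcCells a)
      arcCell leave = _ , here refl
      arcCell (turn a) = arcCell a
      arcCell (go a) = _ , here refl
      y = proj₁ (arcCell arc)
      y∈ = proj₂ (arcCell arc)
      supp′ : Supported filled
      supp′ z p = [ supp z , inj₂ ∘ pocket-bounded B near-B z ] (filled⁻ p)
      exit-near : ∀ {s} → s ∈ allExits → s ∈ keys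
      exit-near {s} s∈ = ∈-keys (near-suc (All.lookup near-B (subst (proj₁ s ∈_) (sym cells-eq)
        (weaken (∈-++⁻ (arcCells arc) (subst (proj₁ s ∈_) allExits-cells (∈-map⁺ proj₁ s∈)))))))
        where
        weaken : ∀ {v} → v ∈ arcCells arc ⊎ v ∈ x ∷ [] → v ∈ arcCells arc ++ x ∷ olderCells
        weaken (inj₁ p) = ∈-++⁺ˡ p
        weaken (inj₂ (here p)) = ∈-++⁺ʳ (arcCells arc) (here p)
      exits-lost : length allExits + Λ filled ≤ Λ A
      exits-lost = Λ-+ filled A allExits (λ s → corner-filled {s}) allExits-unique
        (All.tabulate λ s∈ → exit-near s∈ , All.lookup exit-corner s∈)
      found : ∃₂ λ ws δ → Stab A bs ws δ × (∀ v → v ∈ ws → v ∈ x ∷ olderCells) ×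
        δ ≤ suc (length (arcCells arc))
      found = search shape
        where
        bound : ∀ {δ n} → δ ≤ n + 0 → δ ≤ n
        bound {δ} {n} p = subst (δ ≤_) (ℕₚ.+-identityʳ n) p
        search : cells T ≡ vs ⊎ (∃ λ m → cells T ≡ m ∷ vs) → _
        search (inj₁ eq) =
          let ws , δ , st , sub , le = stabs-lookup vs stabs (arcCells arc) (trans (sym eq) cells-eq)
          in ws , δ , st , sub , bound le
        -- The arc is nonempty, so its newest cell is `m`, which `stabs` does not list yet.
        search (inj₂ (m , eq)) = peel (arcCells arc) y∈ (trans (sym eq) cells-eq)
          where
          peel : ∀ as → y ∈ as → m ∷ vs ≡ as ++ x ∷ olderCells →
            ∃₂ λ ws δ → Stab A bs ws δ × (∀ v → v ∈ ws → v ∈ x ∷ olderCells) × δ ≤ suc (length as)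
          peel (a ∷ as) _ e =
            let ws , δ , st , sub , le = stabs-lookup vs stabs as (Listₚ.∷-injectiveʳ e)
            in ws , δ , st , sub , ℕₚ.m≤n⇒m≤1+n (bound le)
      δ = proj₁ (proj₂ found)

    module _ {x : Cell} (near-x : Near B x) (x∉A : A x ≡ false) (x∉vs : x ∉ vs)
      (avoids : All (λ v → A v ≡ false) vs) where

      stab-add : 2 * burnt bs (add x A) + Λ A < 2 * burnt bs A + Λ (add x A)
      stab-add = stabs-head vs stabs (add x A) (⊑-add x A)
        (λ z p → [ supp z , (λ { refl → inj₂ near-x }) ] (add⁻ x A z p))
        (All.tabulate λ {v} v∈ → trans (add-≢ x A v λ { refl → x∉vs v∈ }) (All.lookup avoids v∈))
        x (add-self x A) x∉A

      -- Adding a burnt cell gains 2 and costs at most 2 left turns, so the extended region would at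
      -- least tie, contradicting stability.
      touching⇒unburnt : ∀ k → A (mv k x) ≡ true → x ∉ bs
      touching⇒unburnt k p x∈ = ℕₚ.<-irrefl refl (begin-strict
        2 * burnt bs A + Λ (add x A)       ≤⟨ ℕₚ.+-monoʳ-≤ _ (add-touching A x near-x x∉A k p) ⟩
        2 * burnt bs A + (2 + Λ A)         ≡⟨ eq (burnt bs A) (Λ A) ⟩
        2 * suc (burnt bs A) + Λ A         ≤⟨ ℕₚ.+-monoˡ-≤ (Λ A) (ℕₚ.*-monoʳ-≤ 2 (burnt-add bs x∈ x∉A)) ⟩
        2 * burnt bs (add x A) + Λ A       <⟨ stab-add ⟩
        2 * burnt bs A + Λ (add x A)       ∎)
        where
        open ℕₚ.≤-Reasoning
        eq : ∀ a l → 2 * a + (2 + l) ≡ 2 * suc a + l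
        eq = solve-∀

      -- Such a cell could be added without any new left turn on balance. This limits the runner to
      -- one turn on the spot between his two moves.
      not-surrounded : ∀ k → A (mv k x) ≡ true → A (mv (k ⁻) x) ≡ true → A (mv (k ⁻ ⁻) x) ≢ true
      not-surrounded k p q r = ℕₚ.<-irrefl refl (begin-strict
        2 * burnt bs A + Λ (add x A)       ≤⟨ ℕₚ.+-mono-≤ (ℕₚ.*-monoʳ-≤ 2 (burnt-mono bs (⊑-add x A)))
                                                (add-surrounded A x near-x x∉A k p q r) ⟩
        2 * burnt bs (add x A) + Λ A       <⟨ stab-add ⟩
        2 * burnt bs A + Λ (add x A)       ∎)
        where open ℕₚ.≤-Reasoning

  module _ {A : Region} where
    record Ready (z : Cell) (cs : List Cell) : Set where
      field
        {dir} : Dir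
        trail : Trail z dir
        wall  : All (OnWall A) (states trail)
        below : proj₂ (origin trail) ℤ.< + 0
        same  : cells trail ≡ cs
        open′ : A (mv (dir ⁻) z) ≡ false

    rotate : ∀ {z k} n (T : Trail z k) → All (OnWall A) (states T) → proj₂ (origin T) ℤ.< + 0 →
      A (mv (k ⊝ suc n) z) ≡ false → Ready z (cells T)
    rotate {z} {k} n T wall below out = case A (mv (k ⁻) z) 𝔹.≟ true of λ where
        (no ¬p) → record { trail = T ; wall = wall ; below = below ; same = refl ; open′ = 𝔹.¬-not ¬p }
        (yes p) → next n out p
      where
      next : ∀ n → A (mv (k ⊝ suc n) z) ≡ false → A (mv (k ⁻) z) ≡ true → Ready z (cells T)
      next zero out p = ⊥-elim (false≢true out p)
      next (suc n) out p = rotate n (turn T) ((proj₁ (All.lookup wall (current∈states T)) , p) ∷ wall) below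
        (trans (cong (λ d → A (mv (d ⁻) z)) (⊝-shift k n)) out)

  -- `f` turns are still to be played. `stabs` concerns `older` because the wall was chosen before
  -- the last two moves; `room` reserves space in the window for two moves per remaining turn.
  record Position (f : ℕ) (z : Cell) (bs : List Cell) : Set where
    field
      {wallRegion} : Region
      {dir}     : Dir
      {older}   : List Cell
      {reach}   : ℕ
      half⊑     : halfPlane ⊑ wallRegion
      supported : Supported wallRegion
      trail     : Trail z dir
      wall      : All (OnWall wallRegion) (states trail)
      unique    : Unique (cells trail)
      below     : proj₂ (origin trail) ℤ.< + 0
      two-moves : cells trail ≡ z ∷ mv (dir ⁺) z ∷ older
      stabs     : Stabs wallRegion bs older 0
      near-all  : All (Near reach) (cells trail)
      room      : reach + 2 * f ≤ B

  module Move {f z bs} (P : Position (suc f) z bs) (b : Cell) where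
    open Position P renaming (wallRegion to A)

    vs : List Cell
    vs = cells trail

    off-wall : All (λ v → A v ≡ false) vs
    off-wall = All.tabulate λ v∈ → proj₁ (All.lookup wall (proj₂ (cell⇒state trail v∈)))

    budget : ∀ m f → m + 2 * suc f ≡ 2 + m + 2 * f
    budget = solve-∀

    2+reach≤B : 2 + reach ≤ B
    2+reach≤B = ℕₚ.≤-trans (ℕₚ.m≤m+n (2 + reach) (2 * f)) (subst (_≤ B) (budget reach f) room)

    near-B : All (Near B) vs
    near-B = All.map (near-≤ (ℕₚ.≤-trans (ℕₚ.m≤n+m reach 2) 2+reach≤B)) near-all

    module _ (O : Optimum A (b ∷ bs) vs) where
      open Optimum O renaming (region to A′; supported to supp′)

      half⊑′ : halfPlane ⊑ A′
      half⊑′ z p = extends z (half⊑ z p)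

      wall′ : All (OnWall A′) (states trail)
      wall′ = All.tabulate λ s∈ → All.lookup avoids (state⇒cell trail s∈) ,
        extends _ (proj₂ (All.lookup wall s∈))

      stabs′ : Stabs A′ (b ∷ bs) vs 0
      -- The new optimum supplies the entry with slack 0, and every earlier entry is weakened by 2
      -- through `stab-burn`.
      stabs′ = subst (λ cs → Stabs A′ (b ∷ bs) cs 0) (sym two-moves)
        ( subst (λ cs → Stab A′ (b ∷ bs) cs 0) two-moves stable
        , stabs-map (stab-burn {A} {bs} {A′} {b} extends (ℕₚ.≤-trans
            (ℕₚ.+-monoˡ-≤ (Λ A′) (ℕₚ.*-monoʳ-≤ 2 (ℕₚ.m≤n+m (burnt bs A) (bit (A b))))) gain)) older stabs)

      -- The runner came from direction `dir ⁺`, five clockwise steps away, and visited cells stay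
      -- outside; hence his rotation must find an opening.
      prev∉A′ : A′ (mv (dir ⊝ 5) z) ≡ false
      prev∉A′ = subst (λ d → A′ (mv d z) ≡ false) (⊝5 dir)
        (All.lookup avoids (subst (mv (dir ⁺) z ∈_) (sym two-moves) (there (here refl))))
        where
        ⊝5 : ∀ d → d ⁺ ≡ d ⊝ 5
        ⊝5 = from-yes (∀dir? λ d → d ⁺ ≟ᵈ d ⊝ 5)

      first : Ready {A′} z vs
      first = rotate 4 trail wall′ below prev∉A′

      module _ (R : Ready {A′} z vs) where
        private module R = Ready R

        m : Cell
        m = mv (R.dir ⁻) z

        κ : Dir
        κ = R.dir ⁺

        m-fresh : m ∉ vs
        m-fresh = subst (m ∉_) R.same (fresh half⊑′ supp′ stabs′ R.trail R.wall
          (subst Unique (sym R.same) unique) R.below (subst (All (Near B)) (sym R.same) near-B) (inj₁ R.same))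

        near-m : Near (suc reach) m
        near-m = near-mv (R.dir ⁻) (All.lookup near-all (current∈cells trail))

        near-m-B : Near B m
        near-m-B = near-≤ (ℕₚ.≤-trans (ℕₚ.n≤1+n _) 2+reach≤B) near-m

        m-left : A′ (mv κ m) ≡ true
        m-left = subst (λ c → A′ c ≡ true) (sym (mv-tri R.dir z))
          (proj₂ (All.lookup R.wall (current∈states R.trail)))

        unique₁ : Unique (m ∷ vs)
        unique₁ = Allₚ.¬Any⇒All¬ _ m-fresh ∷ unique

        -- If the way ahead is blocked, one turn on the spot suffices: otherwise `m` would have
        -- three consecutive wall neighbours.
        second : Σ (Ready {A′} m (m ∷ vs)) λ S → Ready.dir S ≡ κ ⊎ Ready.dir S ≡ κ ⁻
        second = case A′ (mv (κ ⁻) m) 𝔹.≟ true of λ where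
            (no ¬p) → record { trail = go R.trail ; wall = (R.open′ , m-left) ∷ R.wall ; below = R.below
              ; same = cong (m ∷_) R.same ; open′ = 𝔹.¬-not ¬p } , inj₁ refl
            (yes p) → record { trail = turn (go R.trail) ; wall = (R.open′ , p) ∷ (R.open′ , m-left) ∷ R.wall
              ; below = R.below ; same = cong (m ∷_) R.same
              ; open′ = 𝔹.¬-not (not-surrounded half⊑′ supp′ stabs′ near-m-B R.open′ m-fresh avoids κ m-left p) }
              , inj₂ refl

        module _ (S : Ready {A′} m (m ∷ vs)) (S-dir : Ready.dir S ≡ κ ⊎ Ready.dir S ≡ κ ⁻) where
          private module S = Ready S

          z′ : Cell
          z′ = mv (S.dir ⁻) m

          z′-left : A′ (mv (S.dir ⁺) z′) ≡ true
          z′-left = subst (λ c → A′ c ≡ true) (sym (mv-tri S.dir m))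
            (proj₂ (All.lookup S.wall (current∈states S.trail)))

          z′-fresh : z′ ∉ m ∷ vs
          z′-fresh = subst (z′ ∉_) S.same (fresh half⊑′ supp′ stabs′ S.trail S.wall
            (subst Unique (sym S.same) unique₁) S.below
            (subst (All (Near B)) (sym S.same) (near-m-B ∷ near-B)) (inj₂ (m , S.same)))

          unburnt : z′ ∉ b ∷ bs
          unburnt = touching⇒unburnt half⊑′ supp′ stabs′ (near-≤ 2+reach≤B (near-mv (S.dir ⁻) near-m))
            S.open′ (z′-fresh ∘ there) avoids (S.dir ⁺) z′-left

          -- Without a turn on the spot at `m` the path bends left around the same wall cell; with
          -- one it goes straight on.
          jump : z ⇝ z′
          jump = R.dir ⁻ , (case S-dir of λ where
            (inj₁ p) → inj₂ (cong (λ d → mv d m) (trans (cong _⁻ p) (trans (⁺⁻ R.dir) (sym (⁻⁺ R.dir)))))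
            (inj₂ p) → inj₁ (cong (λ d → mv d m) (trans (cong _⁻ p) (cong _⁻ (⁺⁻ R.dir)))))

          mv-back : ∀ d c → mv (d ⁺ ⁺) (mv (d ⁻) c) ≡ c
          mv-back d c = trans (cong (λ e → mv (e ⁺ ⁺) (mv (d ⁻) c)) (sym (⁻⁺ d))) (mv-opp (d ⁻) c)

          arrive : Position f z′ (b ∷ bs)
          arrive = record
            { half⊑ = half⊑′ ; supported = supp′ ; trail = go S.trail ; wall = (S.open′ , z′-left) ∷ S.wall
            ; unique = subst (Unique ∘ (z′ ∷_)) (sym S.same) (Allₚ.¬Any⇒All¬ _ z′-fresh ∷ unique₁)
            ; below = S.below
            ; two-moves = cong (z′ ∷_) (trans S.same (cong (_∷ vs) (sym (mv-back S.dir m))))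
            ; stabs = stabs′
            ; near-all = subst (All (Near (2 + reach))) (cong (z′ ∷_) (sym S.same))
                (near-mv (S.dir ⁻) near-m ∷ near-suc near-m ∷ All.map (near-suc ∘ near-suc) near-all)
            ; room = subst (_≤ B) (budget reach f) room }

  step : ∀ {f z bs} → Position (suc f) z bs → ∀ b →
    ∃ λ z′ → z ⇝ z′ × z′ ∉ b ∷ bs × Position f z′ (b ∷ bs)
  step {f} {z} {bs} P b = choose (optimise A (b ∷ bs) (cells trail) half⊑ supported (Move.off-wall P b))
    where
    open Position P renaming (wallRegion to A)
    choose : Optimum A (b ∷ bs) (cells trail) → _
    choose O = choose₁ (first O)
      where
      open Move P b
      choose₁ : Ready {Optimum.region O} z vs → _
      choose₁ R = choose₂ (second O R)
        where
        choose₂ : (Σ (Ready {Optimum.region O} _ _) λ S → Ready.dir S ≡ _ ⊎ Ready.dir S ≡ _) → _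
        choose₂ (S , d) = z′ O R S d , jump O R S d , unburnt O R S d , arrive O R S d

Survives : ℕ → Cell → List Cell → Set
Survives f z bs = ∃ λ B → Turn.Position B f z bs

-- The trail starts with the two fictitious moves (2,0), (1,0), (0,0) along the half plane.
survives-origin : ∀ f → Survives f (+ 0 , + 0) []
survives-origin f = 2 + 2 * f , record
  { half⊑ = λ _ p → p
  ; reach = 2
  ; supported = λ _ → inj₁
  ; trail = go (turn (go (start (+ 2 , + 0) d4)))
  ; wall = (refl , refl) ∷ (refl , refl) ∷ (refl , refl) ∷ (refl , refl) ∷ []
  ; unique = ((λ ()) ∷ (λ ()) ∷ []) ∷ ((λ ()) ∷ []) ∷ [] ∷ []
  ; below = ℤ.-<+
  ; two-moves = refl
  -- Nothing is burnt yet, so stability only compares numbers of left turns.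
  ; stabs = λ C half⊑C supp _ z z∈ z∉ → halfPlane-minimal C half⊑C supp z z∈ z∉
  ; near-all = near z≤n z≤n ∷ near (s≤s z≤n) z≤n ∷ near (s≤s (s≤s z≤n)) z≤n ∷ []
  ; room = ℕₚ.≤-refl {2 + 2 * f} }
  where open Counting (2 + 2 * f)

survives-step : ∀ {f z bs} → Survives (suc f) z bs → ∀ b →
  ∃ λ z′ → z ⇝ z′ × z′ ∉ b ∷ bs × Survives f z′ (b ∷ bs)
survives-step (B , P) b = let z′ , j , u , P′ = Turn.step B P b in z′ , j , u , B , P′

-- The game on the wedge

infixr 6 _⊞_
_⊞_ : Cell → Cell → Cell
(i , j) ⊞ (i′ , j′) = i ℤ.+ i′ , j ℤ.+ j′

⊞-assoc : ∀ a b c → (a ⊞ b) ⊞ c ≡ a ⊞ (b ⊞ c)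
⊞-assoc (a , a′) (b , b′) (c , c′) = cong₂ _,_ (ℤₚ.+-assoc a b c) (ℤₚ.+-assoc a′ b′ c′)

⊞-comm : ∀ a b → a ⊞ b ≡ b ⊞ a
⊞-comm (a , a′) (b , b′) = cong₂ _,_ (ℤₚ.+-comm a b) (ℤₚ.+-comm a′ b′)

⊞-left-comm : ∀ a b c → a ⊞ (b ⊞ c) ≡ b ⊞ (a ⊞ c)
⊞-left-comm a b c = trans (sym (⊞-assoc a b c)) (trans (cong (_⊞ c) (⊞-comm a b)) (⊞-assoc b a c))

unit : Dir → Cell
unit d = vx d , vy d

mv-⊞ : ∀ d z → mv d z ≡ unit d ⊞ z
mv-⊞ d (i , j) = cong₂ _,_ (dx-+ d i) (dy-+ d j)

straight bent : Dir → Cell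
straight e = unit e ⊞ unit e
bent e = unit (e ⁺) ⊞ unit e

jumps : List Cell
jumps = map straight dirs ++ map bent dirs

⇝-jump : ∀ {z z′} → z ⇝ z′ → ∃ λ v → v ∈ jumps × z′ ≡ v ⊞ z
⇝-jump {z} (e , inj₁ eq) = straight e , ∈-++⁺ˡ (∈-map⁺ straight (∈-dirs e)) ,
  trans eq (trans (mv-⊞ e _) (trans (cong (unit e ⊞_) (mv-⊞ e z)) (sym (⊞-assoc (unit e) (unit e) z))))
⇝-jump {z} (e , inj₂ eq) = bent e , ∈-++⁺ʳ (map straight dirs) (∈-map⁺ bent (∈-dirs e)) ,
  trans eq (trans (mv-⊞ (e ⁺) _) (trans (cong (unit (e ⁺) ⊞_) (mv-⊞ e z)) (sym (⊞-assoc (unit (e ⁺)) (unit e) z))))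

times : ℕ → Cell → Cell → Cell
times zero v z = z
times (suc n) v z = v ⊞ times n v z

times-⊞ : ∀ n u v z → times n u (v ⊞ z) ≡ v ⊞ times n u z
times-⊞ zero u v z = refl
times-⊞ (suc n) u v z = trans (cong (u ⊞_) (times-⊞ n u v z)) (⊞-left-comm u v _)

-- The additive map taking the coordinate directions to the listed displacements and any further
-- ones to zero. Raising one coordinate thus performs one jump.
project : ∀ {d} → List Cell → Pt d → Cell
project [] x = + 0 , + 0
project (v ∷ vs) [] = + 0 , + 0
project (v ∷ vs) (n ∷ x) = times n v (project vs x)

project-zero : ∀ d vs → project vs (Vec.replicate d 0) ≡ (+ 0 , + 0)
project-zero zero [] = refl
project-zero zero (v ∷ vs) = refl
project-zero (suc d) [] = refl
project-zero (suc d) (v ∷ vs) = project-zero d vs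

sum-zero : ∀ d → Vec.sum (Vec.replicate d 0) ≡ 0
sum-zero zero = refl
sum-zero (suc d) = sum-zero d

raise : ∀ {d v} vs (x : Pt d) → v ∈ vs → length vs ≤ d →
  ∃ λ y → x ≺ y × Vec.sum y ≡ suc (Vec.sum x) × project vs y ≡ v ⊞ project vs x
raise (v ∷ vs) (n ∷ x) (here refl) le =
  suc n ∷ x , ((ℕₚ.n≤1+n n ∷ Pointwise.refl ℕₚ.≤-refl) , λ e → ℕₚ.1+n≢n (sym (Vecₚ.∷-injectiveˡ e))) , refl , refl
raise {v = v} (u ∷ vs) (n ∷ x) (there v∈) (s≤s le) =
  let y , (x⪯y , x≢y) , s , p = raise vs x v∈ le
  in n ∷ y , ((ℕₚ.≤-refl ∷ x⪯y) , x≢y ∘ Vecₚ.∷-injectiveʳ) ,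
     trans (cong (λ s → n + s) s) (ℕₚ.+-suc n _) , trans (cong (times n u) p) (times-⊞ n u v (project vs x))

mutual
  data Even {A : Set} : List A → Set where
    []  : Even []
    _∷_ : ∀ x {xs} → Odd xs → Even (x ∷ xs)

  data Odd {A : Set} : List A → Set where
    _∷_ : ∀ x {xs} → Even xs → Odd (x ∷ xs)

mutual
  even-snoc : ∀ {A : Set} {h : List A} {x} → Even h → Odd (h ∷ʳ x)
  even-snoc [] = _ ∷ []
  even-snoc (y ∷ o) = y ∷ odd-snoc o

  odd-snoc : ∀ {A : Set} {h : List A} {x} → Odd h → Even (h ∷ʳ x)
  odd-snoc (y ∷ e) = y ∷ even-snoc e

mutual
  walker-even : ∀ {A : Set} {h : List A} {x} → Even h → walkerPart (h ∷ʳ x) ≡ walkerPart h ∷ʳ x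
  walker-even [] = refl
  walker-even (y ∷ o) = cong (y ∷_) (blocker-odd o)

  blocker-odd : ∀ {A : Set} {h : List A} {x} → Odd h → blockerPart (h ∷ʳ x) ≡ blockerPart h ∷ʳ x
  blocker-odd (y ∷ e) = walker-even e

mutual
  walker-odd : ∀ {A : Set} {h : List A} {x} → Odd h → walkerPart (h ∷ʳ x) ≡ walkerPart h
  walker-odd (y ∷ e) = cong (y ∷_) (blocker-even e)

  blocker-even : ∀ {A : Set} {h : List A} {x} → Even h → blockerPart (h ∷ʳ x) ≡ blockerPart h
  blocker-even [] = refl
  blocker-even (y ∷ o) = walker-odd o

mutual
  walker-⊆ : ∀ {A : Set} (h : List A) {x} → walkerPart h ⊆ walkerPart (h ∷ʳ x)
  walker-⊆ [] = minimum _
  walker-⊆ (y ∷ h) = refl ∷ blocker-⊆ h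

  blocker-⊆ : ∀ {A : Set} (h : List A) {x} → blockerPart h ⊆ blockerPart (h ∷ʳ x)
  blocker-⊆ [] = minimum _
  blocker-⊆ (y ∷ h) = walker-⊆ h

∈-parts : ∀ {A : Set} {y : A} h → y ∈ h → y ∈ walkerPart h ⊎ y ∈ blockerPart h
∈-parts (x ∷ h) (here p) = inj₁ (here p)
∈-parts (x ∷ h) (there p) = [ inj₂ , inj₁ ∘ there ] (∈-parts h p)

builds-snoc : ∀ {d m} {h : List (Pt d)} {x} → BuildsChain m h → BuildsChain m (h ∷ʳ x)
builds-snoc {h = h} (c , c⊆ , l , lk) = c , ⊆-trans c⊆ (walker-⊆ h) , l , lk

linked-snoc : ∀ {A : Set} {R : A → A → Set} {x y} c → Linked R (c ∷ʳ x) → R x y → Linked R (c ∷ʳ x ∷ʳ y)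
linked-snoc [] [-] r = r ∷ [-]
linked-snoc (a ∷ []) (p ∷ lk) r = p ∷ linked-snoc [] lk r
linked-snoc (a ∷ b ∷ c) (p ∷ lk) r = p ∷ linked-snoc (b ∷ c) lk r

∈-snoc⁻ : ∀ {A : Set} {x y : A} h → y ∈ h ∷ʳ x → y ∈ h ⊎ y ≡ x
∈-snoc⁻ h y∈ with ∈-++⁻ h y∈
... | inj₁ p = inj₁ p
... | inj₂ (here p) = inj₂ p

boundedPts : ∀ d → ℕ → List (Pt d)
boundedPts zero k = [] ∷ []
boundedPts (suc d) k = cartesianProductWith _∷_ (upTo k) (boundedPts d k)

wedge⊆bounded : ∀ {d k} (x : Pt d) → InWedge k x → x ∈ boundedPts d k
wedge⊆bounded [] _ = here refl
wedge⊆bounded (n ∷ x) lt = ∈-cartesianProductWith⁺ _∷_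
  (∈-upTo⁺ (ℕₚ.≤-<-trans (ℕₚ.m≤m+n n _) lt)) (wedge⊆bounded x (ℕₚ.≤-<-trans (ℕₚ.m≤n+m _ n) lt))

module Game (d k : ℕ) where

  _≟ᵖ_ : (x y : Pt d) → Dec (x ≡ y)
  _≟ᵖ_ = Vecₚ.≡-dec ℕ._≟_

  open DecMembership _≟ᵖ_ using (_∈?_)

  Covers : List (Pt d) → List (Pt d) → Set
  Covers h rem = ∀ x → InWedge k x → x ∉ h → x ∈ rem

  remove : Pt d → List (Pt d) → List (Pt d)
  remove x = filter (λ y → ¬? (y ≟ᵖ x))

  covers-remove : ∀ {h rem x} → Covers h rem → Covers (h ∷ʳ x) (remove x rem)
  covers-remove {h} {x = x} cov y iw y∉ = ∈-filter⁺ (λ y → ¬? (y ≟ᵖ x)) (cov y iw (y∉ ∘ ∈-++⁺ˡ))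
    λ { refl → y∉ (∈-++⁺ʳ h (here refl)) }

  remove-length : ∀ {x rem n} → x ∈ rem → length rem ≤ suc n → length (remove x rem) ≤ n
  remove-length {x} {rem} x∈ le = ℕₚ.≤-pred (ℕₚ.≤-trans
    (Listₚ.filter-notAll (λ y → ¬? (y ≟ᵖ x)) rem (lose x∈ λ ne → ne refl)) le)

  unchosen? : ∀ h rem → Dec (Any (λ x → InWedge k x × x ∉ h) rem)
  unchosen? h rem = Any.any? (λ x → (Vec.sum x ℕ.<? k) ×-dec ¬? (x ∈? h)) rem

  complete : ∀ {h rem} → Covers h rem → ¬ Any (λ x → InWedge k x × x ∉ h) rem → Complete d k h
  complete {h} cov none x iw = case x ∈? h of λ where
    (yes p) → p
    (no x∉) → ⊥-elim (none (lose (cov x iw x∉) (iw , x∉)))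

  mutual
    -- Once the chain exists, any moves will do; `rem` contains all unchosen elements and bounds the
    -- length of the remaining game.
    finishW : ∀ n {m h} rem → length rem ≤ n → Covers h rem → BuildsChain m h → WalkerWinsW d k m h
    finishW n {m} {h} rem le cov bc = case unchosen? h rem of λ where
        (no none) → end (complete cov none) bc
        (yes some) → pick n le some
      where
      pick : ∀ n → length rem ≤ n → Any (λ x → InWedge k x × x ∉ h) rem → WalkerWinsW d k m h
      pick n le some with find some
      pick zero le some | x , x∈ , _ = case ℕₚ.≤-trans (∈-length x∈) le of λ ()
      pick (suc n) le some | x , x∈ , iw , x∉ =
        move x iw x∉ (finishB n (remove x rem) (remove-length x∈ le) (covers-remove cov) (builds-snoc bc))

    finishB : ∀ n {m h} rem → length rem ≤ n → Covers h rem → BuildsChain m h → WalkerWinsB d k m h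
    finishB n {m} {h} rem le cov bc = case unchosen? h rem of λ where
        (no none) → end (complete cov none) bc
        (yes some) → move
          (λ comp → let x , _ , iw , x∉ = find some in x∉ (comp x iw))
          (λ x iw x∉ → reply n le x (cov x iw x∉))
      where
      reply : ∀ n → length rem ≤ n → ∀ x → x ∈ rem → WalkerWinsW d k m (h ∷ʳ x)
      reply zero le x x∈ = case ℕₚ.≤-trans (∈-length x∈) le of λ ()
      reply (suc n) le x x∈ = finishW n (remove x rem) (remove-length x∈ le) (covers-remove cov) (builds-snoc bc)

  -- The state after a move of Walker with `f` levels to go: the cells in `bs` include the
  -- projections of all elements taken by Blocker, and the runner stands at the projection of `top`.
  record Climb (f : ℕ) (h : List (Pt d)) : Set where
    field
      {below} : List (Pt d)
      {top}   : Pt d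
      {bs}    : List Cell
      odd     : Odd h
      chain   : walkerPart h ≡ below ∷ʳ top
      linked  : Linked _≺_ (below ∷ʳ top)
      levels  : length (below ∷ʳ top) ≡ suc (Vec.sum top)
      highest : ∀ {y} → y ∈ walkerPart h → Vec.sum y ≤ Vec.sum top
      blocked : ∀ {y} → y ∈ blockerPart h → project jumps y ∈ bs
      height  : suc (Vec.sum top + f) ≡ k
      alive   : Survives f (project jumps top) bs

  module _ {f h} (C : Climb (suc f) h) (b : Pt d) where
    open Climb C

    climb-to : ∀ {z} → z ∉ project jumps b ∷ bs → Survives f z (project jumps b ∷ bs) →
      (∃ λ y → top ≺ y × Vec.sum y ≡ suc (Vec.sum top) × project jumps y ≡ z) →
      ∃ λ y → InWedge k y × y ∉ h ∷ʳ b × Climb f (h ∷ʳ b ∷ʳ y)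
    climb-to z∉ alive′ (y , top≺y , sum-y , refl) = y , in-wedge , y∉ , record
      { odd = even-snoc (odd-snoc odd)
      ; chain = trans walker′ (cong (_∷ʳ y) chain)
      ; linked = linked-snoc below linked top≺y
      ; levels = trans (Listₚ.length-++ (below ∷ʳ top))
          (trans (ℕₚ.+-comm _ 1) (cong suc (trans levels (sym sum-y))))
      ; highest = λ {u} u∈ → case ∈-snoc⁻ (walkerPart h) (subst (u ∈_) walker′ u∈) of λ where
          (inj₁ p) → ℕₚ.≤-trans (highest p) (subst (Vec.sum top ≤_) (sym sum-y) (ℕₚ.n≤1+n _))
          (inj₂ refl) → ℕₚ.≤-refl
      ; blocked = λ {u} u∈ → case ∈-snoc⁻ (blockerPart h) (subst (u ∈_) blocker′ u∈) of λ where
          (inj₁ p) → there (blocked p)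
          (inj₂ refl) → here refl
      ; height = height′
      ; alive = alive′ }
      where
      walker′ : walkerPart (h ∷ʳ b ∷ʳ y) ≡ walkerPart h ∷ʳ y
      walker′ = trans (walker-even (odd-snoc odd)) (cong (_∷ʳ y) (walker-odd odd))
      blocker′ : blockerPart (h ∷ʳ b ∷ʳ y) ≡ blockerPart h ∷ʳ b
      blocker′ = trans (blocker-even (odd-snoc odd)) (blocker-odd odd)
      height′ : suc (Vec.sum y + f) ≡ k
      height′ = trans (cong (λ s → suc (s + f)) sum-y) (trans (cong suc (sym (ℕₚ.+-suc _ f))) height)
      in-wedge : InWedge k y
      in-wedge = subst (suc (Vec.sum y) ≤_) height′ (s≤s (ℕₚ.m≤m+n _ f))
      -- Walker's elements all lie on lower levels, and Blocker's project to burnt cells, whereas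
      -- `y` projects to an unburnt one.
      y∉ : y ∉ h ∷ʳ b
      y∉ y∈ = case ∈-snoc⁻ h y∈ of λ where
        (inj₂ refl) → z∉ (here refl)
        (inj₁ y∈h) → case ∈-parts h y∈h of λ where
          (inj₁ p) → ℕₚ.<-irrefl refl (subst (_≤ Vec.sum top) sum-y (highest p))
          (inj₂ p) → z∉ (there (blocked p))

    climb-step : 12 ≤ d → ∃ λ y → InWedge k y × y ∉ h ∷ʳ b × Climb f (h ∷ʳ b ∷ʳ y)
    climb-step 12≤d =
      let z , jump , z∉ , alive′ = survives-step alive (project jumps b)
          v , v∈ , z≡ = ⇝-jump jump
          y , top≺y , sum-y , y≡ = raise jumps top v∈ 12≤d
      in climb-to z∉ alive′ (y , top≺y , sum-y , trans y≡ (sym z≡))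

  climbB : 12 ≤ d → ∀ f {h} → Climb f h → WalkerWinsB d k k h
  climbB 12≤d zero {h} C = finishB _ (boundedPts d k) ℕₚ.≤-refl (λ x iw _ → wedge⊆bounded x iw)
    (below ∷ʳ top , subst (_ ⊆_) (sym chain) ⊆-refl
    , trans levels (trans (cong suc (sym (ℕₚ.+-identityʳ _))) height) , linked)
    where open Climb C
  climbB 12≤d (suc f) {h} C = move
    -- That the game is not over is seen from Walker's answer to a fictitious choice of `top` by
    -- Blocker.
    (λ comp → let y , iw , y∉ , _ = climb-step C (Climb.top C) 12≤d in y∉ (∈-++⁺ˡ (comp y iw)))
    (λ b _ _ → let y , iw , y∉ , C′ = climb-step C b 12≤d in move y iw y∉ (climbB 12≤d f C′))

walker-builds : ∀ d k → 12 ≤ d → WalkerCanBuild d k k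
walker-builds d zero _ = end (λ _ ()) ([] , [] , refl , [])
walker-builds d (suc k) 12≤d = move o (s≤s (subst (_≤ k) (sym (sum-zero d)) z≤n)) (λ ())
  (climbB 12≤d k record
    { below = []
    ; odd = o ∷ []
    ; chain = refl
    ; linked = [-]
    ; levels = cong suc (sym (sum-zero d))
    ; highest = λ { (here refl) → ℕₚ.≤-refl }
    ; blocked = λ ()
    ; height = cong (λ s → suc (s + k)) (sum-zero d)
    ; alive = subst (λ z → Survives k z []) (sym (project-zero d jumps)) (survives-origin k) })
  where
  open Game d (suc k)
  o : Pt d
  o = Vec.replicate d 0

theorem2 : (d k : ℕ) → 14 ≤ d → WalkerCanBuild d k k
theorem2 d k 14≤d = walker-builds d k (ℕₚ.≤-trans (ℕₚ.m≤n+m 12 2) 14≤d)
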